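{- Let $\mathbf{H}$ be a finite, atomic, connected hypergraph with carrier $H=\{x_1,\dots,x_n\}$. Then the map $T\mapsto \Pi(\psi(T))$ is an order-isomorphism from the set of constructs of $\mathbf{H}$, ordered by $\le^{\mathbf{H}}$, onto the set of non-empty faces of the polytope $\mathcal{G}(\mathbf{H})$, ordered by inclusion. That is, it is a bijection onto the non-empty faces, and for all constructs $S,T$ one has $S\le^{\mathbf H} T$ if and only if $\Pi(\psi(S))\subseteq\Pi(\psi(T))$.
   Context: A hypergraph $\mathbf{H}$ on a finite set $H$ (its carrier) is a set $\mathbf{H}\subseteq\mathcal{P}(H)\setminus\{\emptyset\}$ with $\bigcup\mathbf{H}=H$; it is atomic if $\{x\}\in\mathbf{H}$ for all $x\in H$. For $X\subseteq H$ put $\mathbf{H}_X=\{Z\in\mathbf{H}: Z\subseteq X\}$, a hypergraph on $X$. $\mathbf{H}$ is connected if there is no partition $H=X_1\cup X_2$ into two non-empty disjoint sets with $\mathbf{H}=\mathbf{H}_{X_1}\cup\mathbf{H}_{X_2}$; a non-empty $X\subseteq H$ is called connected if $\mathbf{H}_X$ is connected. Every finite hypergraph has a unique partition $H=X_1\cup\dots\cup X_m$ into connected components ($\mathbf H_{X_i}$ connected and $\mathbf{H}=\bigcup_i\mathbf{H}_{X_i}$). The notation $\mathbf{H},X\leadsto H_1,\dots,H_n$ means that $H_1,\dots,H_n$ are the connected components of $\mathbf{H}_{H\setminus X}$ (so $n=0$ iff $X=H$), and $\mathbf{H}_i:=\mathbf{H}_{H_i}$. ${\it Sat}(\mathbf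 H)$ is the set of all non-empty connected subsets of $H$. Constructs of a connected hypergraph $\mathbf{H}$ are rooted trees with nodes labelled by non-empty subsets of $H$, defined inductively: for a non-empty $Y\subseteq H$, if $Y=H$ the one-node tree labelled $H$ is a construct; if $Y\neq H$, $\mathbf{H},Y\leadsto H_1,\dots,H_n$ and $T_i$ is a construct of $\mathbf{H}_i$ for each $i$, then the tree $Y(T_1,\dots,T_n)$ whose root is labelled $Y$ and whose subtrees at the children of the root are $T_1,\dots,T_n$ (unordered) is a construct. A construction is a construct all of whose labels are singletons. The order $\le^{\mathbf H}$ on constructs is the smallest reflexive and transitive relation closed under: (i) if $\emptyset\ne Y\subsetneq H$, $\mathbf{H},Y\leadsto K_1,\dots,K_n$, $\emptyset\neq X\subseteq K_1$, $\mathbf{K}_1,X\leadsto H_{11},\dots,H_{1m}$, $T_{1j}$ constructs of $\mathbf H_{1j}$ and $T_i$ constructs of $\mathbf K_i$ ($2\le i\le n$), then $Y(X(T_{11},\dots,T_{1m}),T_2,\dots,T_n)\le^{\mathbf H}(Y\cup X)(T_{11},\dots,T_{1m},T_2,\dots,T_n)$; (ii) if $\mathbf H,Y\leadsto H_1,\dots,H_n$, $T_i$ are constructs of $\mathbf H_i$ ($i\ge 2$) and $T_1\le^{\mathbf H_1}T'_1$, then $Y(T_1,T_2,\dots,T_n)\le^{\mathbf H} Y(T_1',T_2,\dots,T_n)$. For a node labelled $Y$ of a construct $T$, $\uparrow_T(Y)$ is the union of the labels of $Y$ and of all its descendants; $\psi(T)=\{\uparrow_T(Y): Y\text{ a node of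 }T\}$. Geometric realisation: identify $x_i$ with index $i$. For non-empty $A\subseteq\{1,\dots,n\}$, $\pi_A^+=\{(x_1,\dots,x_n)\in\mathbb R^n:\sum_{i\in A}x_i\ge 3^{|A|}\}$ and $\pi_A=\{(x_1,\dots,x_n)\in\mathbb R^n:\sum_{i\in A}x_i= 3^{|A|}\}$. Then $\mathcal{G}(\mathbf H)=\bigcap\{\pi_Y^+: Y\in{\it Sat}(\mathbf H)\setminus\{H\}\}\cap\pi_H$, and for $M\subseteq{\it Sat}(\mathbf H)$, $\Pi(M)=\bigcap\{\pi_Y:Y\in M\}\cap\mathcal G(\mathbf H)$.
   Formalization: The polytope, its faces and the sets Π(ψ(T)) are taken in rational n-space instead of real n-space: points have rational coordinates, and faces are cut out by supporting hyperplanes with rational coefficients. -}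

module Defs where

open import Data.Nat as ℕ using (ℕ; zero; suc; _^_)
open import Data.Fin as Fin using (Fin; zero; suc)
open import Data.Fin.Subset as Sub
  using (Subset; _∈_; _∉_; _∪_; _∩_; _─_; ⋃; ⊤; ⊥; ⁅_⁆; ∣_∣; Nonempty)
open import Data.Bool using (Bool; true; false; if_then_else_)
open import Data.Vec using ([]; _∷_)
open import Data.List using (List; []; _∷_; _++_)
open import Data.List.Relation.Unary.All using (All)
open import Data.List.Relation.Unary.Any using (Any)
open import Data.List.Relation.Unary.AllPairs using (AllPairs)
open import Data.List.Relation.Binary.Pointwise using (Pointwise)
open import Data.List.Relation.Binary.Permutation.Propositional using (_↭_)
open import Data.Product using (Σ; ∃; ∃-syntax; _×_; _,_)
import Data.Integer as ℤ
open import Data.Rational as ℚ using (ℚ; 0ℚ; _+_; _*_)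
open import Relation.Binary.PropositionalEquality using (_≡_; _≢_)
open import Relation.Nullary using (¬_)
open import Relation.Unary using (Pred)

-- Hypergraphs on the carrier Fin n (x_i is identified with index i).
-- A hypergraph is given by the (decidable) set of its hyperedges.

Hypergraph : ℕ → Set
Hypergraph n = Subset n → Bool

module _ {n : ℕ} (E : Hypergraph n) where

  Edge : Subset n → Set
  Edge Z = E Z ≡ true

  IsHypergraph : Set
  IsHypergraph = (E ⊥ ≡ false) × (∀ (x : Fin n) → ∃[ Z ] (Edge Z × x ∈ Z))

  Atomic : Set
  Atomic = ∀ (x : Fin n) → Edge ⁅ x ⁆

  -- H_X is connected: no partition X = X₁ ∪ X₂ into non-empty disjoint
  -- sets with H_X = H_{X₁} ∪ H_{X₂}, i.e. every such partition is
  -- crossed by some hyperedge Z ⊆ X.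
  ConnectedHG : Subset n → Set
  ConnectedHG X = ∀ (X₁ X₂ : Subset n) → X₁ ∪ X₂ ≡ X → X₁ ∩ X₂ ≡ ⊥ →
    Nonempty X₁ → Nonempty X₂ →
    ∃[ Z ] (Edge Z × Z Sub.⊆ X × ¬ (Z Sub.⊆ X₁) × ¬ (Z Sub.⊆ X₂))

  Sat : Subset n → Set
  Sat X = Nonempty X × ConnectedHG X

  IsComponents : Subset n → List (Subset n) → Set
  IsComponents Z Ks =
    All Sat Ks ×
    AllPairs (λ K K′ → K ∩ K′ ≡ ⊥) Ks ×
    ⋃ Ks ≡ Z ×
    (∀ W → Edge W → W Sub.⊆ Z → Any (λ K → W Sub.⊆ K) Ks)

-- Canonical order of a list of (disjoint, non-empty) components:
-- increasing by least element.  Used only to give each unordered tree a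
-- unique list representation.
MinBefore : ∀ {n} → Subset n → Subset n → Set
MinBefore K K′ = ∃[ x ] (x ∈ K × (∀ y → y ∈ K′ → x Fin.< y))

data Tree (n : ℕ) : Set where
  node : Subset n → List (Tree n) → Tree n

-- Constructs of H_X (X ⊆ Fin n).  The children of a node labelled Y are
-- constructs of the components of H_{X∖Y}, listed in the canonical order
-- of those components (so trees, which are unordered, are represented
-- uniquely).
data Construct {n : ℕ} (E : Hypergraph n) : Subset n → Tree n → Set where
  whole : ∀ {X} → Nonempty X → Construct E X (node X [])
  graft : ∀ {X Y Ks ts} → Nonempty Y → Y Sub.⊂ X →
          IsComponents E (X ─ Y) Ks → AllPairs MinBefore Ks →
          Pointwise (Construct E) Ks ts →
          Construct E X (node Y ts)

data _≤[_∣_]_ {n : ℕ} : Tree n → Hypergraph n → Subset n → Tree n → Set where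
  ≤-refl  : ∀ {E X T} → T ≤[ E ∣ X ] T
  ≤-trans : ∀ {E X S T U} → S ≤[ E ∣ X ] T → T ≤[ E ∣ X ] U → S ≤[ E ∣ X ] U
  ≤-merge : ∀ {E X Y X′ ts₁ ss ts₂ us} →
            Construct E X (node Y (ts₁ ++ node X′ ss ∷ ts₂)) →
            us ↭ (ss ++ ts₁ ++ ts₂) →
            Construct E X (node (Y ∪ X′) us) →
            node Y (ts₁ ++ node X′ ss ∷ ts₂) ≤[ E ∣ X ] node (Y ∪ X′) us
  ≤-child : ∀ {E X Y K ts₁ t t′ ts₂} →
            Construct E X (node Y (ts₁ ++ t ∷ ts₂)) →
            Construct E K t →
            t ≤[ E ∣ K ] t′ →
            node Y (ts₁ ++ t ∷ ts₂) ≤[ E ∣ X ] node Y (ts₁ ++ t′ ∷ ts₂)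

mutual
  up : ∀ {n} → Tree n → Subset n
  up (node Y ts) = Y ∪ upList ts

  upList : ∀ {n} → List (Tree n) → Subset n
  upList []       = ⊥
  upList (t ∷ ts) = up t ∪ upList ts

mutual
  ψ : ∀ {n} → Tree n → List (Subset n)
  ψ (node Y ts) = up (node Y ts) ∷ ψList ts

  ψList : ∀ {n} → List (Tree n) → List (Subset n)
  ψList []       = []
  ψList (t ∷ ts) = ψ t Data.List.++ ψList ts

Point : ℕ → Set
Point n = Fin n → ℚ

sumOver : ∀ {n} → Subset n → Point n → ℚ
sumOver {zero}  []      x = 0ℚ
sumOver {suc n} (b ∷ p) x =
  (if b then x zero else 0ℚ) + sumOver p (λ i → x (suc i))

three^ : ℕ → ℚ
three^ k = (ℤ.+ (3 ^ k)) ℚ./ 1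

πplus : ∀ {n} → Subset n → Pred (Point n) _
πplus A x = three^ ∣ A ∣ ℚ.≤ sumOver A x

πeq : ∀ {n} → Subset n → Pred (Point n) _
πeq A x = sumOver A x ≡ three^ ∣ A ∣

𝒢 : ∀ {n} → Hypergraph n → Pred (Point n) _
𝒢 E x = (∀ Y → Sat E Y → Y ≢ ⊤ → πplus Y x) × πeq ⊤ x

Πof : ∀ {n} → Hypergraph n → List (Subset n) → Pred (Point n) _
Πof E M x = All (λ Y → πeq Y x) M × 𝒢 E x

dot : ∀ {n} → Point n → Point n → ℚ
dot c x = sumOver ⊤ (λ i → c i * x i)

IsFace : ∀ {n} → Pred (Point n) _ → Pred (Point n) _ → Set
IsFace P F = ∃[ c ] ∃[ d ] ((∀ x → P x → dot c x ℚ.≤ d) ×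
  (∀ x → (F x → P x × dot c x ≡ d) × (P x × dot c x ≡ d → F x)))

{-# OPTIONS --safe #-}

-- For c in the normal cone of a construct T, telescoping along T writes
-- c · x = M x(⊤) - Σ λ_A x(A) with A ∈ ψ(T) and λ_A > 0.  So such a c is maximal on 𝒢 exactly
-- where all sets of ψ(T) are tight; conversely every functional c has such an expression over the
-- construct that repeatedly removes the set where c is maximal.  Distributing, in each node, the
-- mass 3^|X| - Σ 3^|K_j| left over by the children evenly over the label gives a point of
-- Π(ψ(T)) at which no other connected set is tight: k 3^b + j 3^r < j 3^(k+r) whenever
-- 1 ≤ j ≤ k, b ≤ j + r and b < k + r.  Hence Π(ψ(S)) ⊆ Π(ψ(T)) means ψ(T) ⊆ ψ(S), which by
-- merging children of S into the root and recursing into the children means S ≤ T.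
module Submission where

open import Defs
open import Algebra.Properties.Group using (∙-cancelˡ)
open import Data.Bool as Bool using (true; false; if_then_else_; _∨_)
open import Data.Empty using (⊥-elim)
open import Data.Fin as Fin using (Fin; zero; suc)
import Data.Fin.Properties as Fin
open import Data.Fin.Subset
  using (Subset; _∈_; _∉_; _⊆_; _⊂_; _⊃_; _∪_; _∩_; _─_; ⋃; ⊤; ⊥; ∣_∣; Nonempty)
open import Data.Fin.Subset.Induction using (⊂-wellFounded; ⊃-wellFounded; Acc; acc)
open import Data.Fin.Subset.Properties
import Data.Integer as ℤ
import Data.Integer.Properties as ℤ
open import Data.List using (List; []; _∷_; [_]; _++_; map)
import Data.List.Properties as List
open import Data.List.Membership.Propositional using (find; lose) renaming (_∈_ to _∈ˡ_)
open import Data.List.Membership.Propositional.Properties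
  using (∈-map⁺; ∈-++⁺ˡ; ∈-++⁺ʳ; ∈-++⁻; ∈-∃++; ∈-insert)
open import Data.List.Relation.Binary.Permutation.Propositional
  using (_↭_; ↭-refl; ↭-sym; ↭-trans; prep; swap; ↭⇒↭ₛ)
open import Data.List.Relation.Binary.Permutation.Propositional.Properties
  using (All-resp-↭; Any-resp-↭; ∈-resp-↭; shift; map⁺)
import Data.List.Relation.Binary.Permutation.Setoid.Properties as ↭ₛ
open import Data.List.Relation.Binary.Pointwise using (Pointwise; []; _∷_; Pointwise-≡⇒≡)
open import Data.List.Relation.Unary.All as All using (All; []; _∷_)
import Data.List.Relation.Unary.All.Properties as All
open import Data.List.Relation.Unary.AllPairs as AllPairs using (AllPairs; []; _∷_)
import Data.List.Relation.Unary.AllPairs.Properties as AllPairs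
open import Data.List.Relation.Unary.Any as Any using (Any; here; there)
import Data.List.Relation.Unary.Any.Properties as Any
open import Data.Nat as ℕ using (ℕ; zero; suc; z≤n; s≤s; _^_)
import Data.Nat.Properties as ℕ
open import Data.Nat.Tactic.RingSolver using (solve-∀)
open import Data.Product using (∃; ∃-syntax; _×_; _,_; proj₁; proj₂)
open import Data.Rational as ℚ using (ℚ; 0ℚ; 1ℚ; _+_; _*_; _-_; -_)
import Data.Rational.Properties as ℚ
open import Data.Rational.Solver using (module +-*-Solver)
import Data.Rational.Unnormalised as ℚᵘ
import Data.Rational.Unnormalised.Properties as ℚᵘ
open import Data.Sum as Sum using (_⊎_; inj₁; inj₂; [_,_]′)
open import Data.Vec using ([]; _∷_; here; there; tabulate; lookup)
open import Data.Vec.Properties using (lookup∘tabulate; []=⇒lookup; lookup⇒[]=)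
open import Function using (_∘_; id; _on_)
open import Relation.Binary using (tri<; tri≈; tri>)
open import Relation.Binary.PropositionalEquality hiding ([_])
open import Relation.Nullary using (¬_; Dec; yes; no; does; ¬?; _×-dec_)
open import Relation.Unary using (Pred; Decidable; _≐_) renaming (_⊆_ to _⊆ₚ_)

-- The argument is linear-programming duality: the telescoped expression is a dual solution, and
-- strict positivity of its coefficients makes complementary slackness an exact description of the
-- maximisers. Genericity then makes the description faithful: without a point at which only the
-- sets of ψ(T) are tight, two constructs might cut out the same face. The base 3 matters where a
-- connected set B ≠ X contains the whole label Y of the root. Then 3^b + 3^r < 3^(k+r) is required
-- although b and r may both equal k + r - 1. Base 2 would give equality: for two points joined by
-- an edge, x ≥ 2, y ≥ 2 and x + y = 4 leave a single point, while there are three constructs. A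
-- further obstacle is the representation. Trees are unordered, but children are listed by least
-- elements, so each merge has to sort the new children again, and equality of constructs rests on
-- the uniqueness of the sorted list of components.

private variable
  n : ℕ
  A : Set

-- Subsets and their sums

Disjoint : Subset n → Subset n → Set
Disjoint A B = ∀ {i} → i ∈ A → i ∉ B

∩≡⊥⇒Disjoint : ∀ {A B : Subset n} → A ∩ B ≡ ⊥ → Disjoint A B
∩≡⊥⇒Disjoint eq i∈A i∈B = ∉⊥ (subst (_ ∈_) eq (x∈p∩q⁺ (i∈A , i∈B)))

Disjoint⇒∩≡⊥ : ∀ {A B : Subset n} → Disjoint A B → A ∩ B ≡ ⊥
Disjoint⇒∩≡⊥ {A = A} {B} d =
  Empty-unique λ (i , i∈) → let i∈A , i∈B = x∈p∩q⁻ A B i∈ in d i∈A i∈B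

x∈p─q⇒x∉q : ∀ (p q : Subset n) {x} → x ∈ p ─ q → x ∉ q
x∈p─q⇒x∉q (true  ∷ p) (true  ∷ q) ()         here
x∈p─q⇒x∉q (false ∷ p) (true  ∷ q) ()         here
x∈p─q⇒x∉q (true  ∷ p) (s     ∷ q) (there x∈) (there x∈q) = x∈p─q⇒x∉q p q x∈ x∈q
x∈p─q⇒x∉q (false ∷ p) (s     ∷ q) (there x∈) (there x∈q) = x∈p─q⇒x∉q p q x∈ x∈q

q∪p─q≡p : ∀ {p q : Subset n} → q ⊆ p → q ∪ (p ─ q) ≡ p
q∪p─q≡p {p = p} {q} q⊆p = ⊆-antisym to from
  where
  to : q ∪ (p ─ q) ⊆ p
  to i∈ with x∈p∪q⁻ q (p ─ q) i∈
  ... | inj₁ i∈q = q⊆p i∈q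
  ... | inj₂ i∈r = p─q⊆p p q i∈r
  from : p ⊆ q ∪ (p ─ q)
  from {i} i∈p with i ∈? q
  ... | yes i∈q = x∈p∪q⁺ (inj₁ i∈q)
  ... | no  i∉q = x∈p∪q⁺ (inj₂ (x∈p∧x∉q⇒x∈p─q i∈p i∉q))

Disjoint-─ : ∀ (p q : Subset n) → Disjoint q (p ─ q)
Disjoint-─ p q i∈q i∈r = x∈p─q⇒x∉q p q i∈r i∈q

∣p∪q∣≡∣p∣+∣q∣ : ∀ (p q : Subset n) → Disjoint p q → ∣ p ∪ q ∣ ≡ ∣ p ∣ ℕ.+ ∣ q ∣
∣p∪q∣≡∣p∣+∣q∣ [] [] d = refl
∣p∪q∣≡∣p∣+∣q∣ (true ∷ p) (true ∷ q) d = ⊥-elim (d here here)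
∣p∪q∣≡∣p∣+∣q∣ (true ∷ p) (false ∷ q) d =
  cong suc (∣p∪q∣≡∣p∣+∣q∣ p q λ i j → d (there i) (there j))
∣p∪q∣≡∣p∣+∣q∣ (false ∷ p) (true ∷ q) d = trans
  (cong suc (∣p∪q∣≡∣p∣+∣q∣ p q λ i j → d (there i) (there j)))
  (sym (ℕ.+-suc ∣ p ∣ ∣ q ∣))
∣p∪q∣≡∣p∣+∣q∣ (false ∷ p) (false ∷ q) d =
  ∣p∪q∣≡∣p∣+∣q∣ p q λ i j → d (there i) (there j)

∣p∣>0 : ∀ {p : Subset n} → Nonempty p → 1 ℕ.≤ ∣ p ∣
∣p∣>0 {p = true  ∷ p} _ = s≤s z≤n
∣p∣>0 {p = false ∷ p} (suc i , there i∈p) = ∣p∣>0 (i , i∈p)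

∣p∣+∣q─p∣≡∣q∣ : ∀ {p q : Subset n} → p ⊆ q → ∣ p ∣ ℕ.+ ∣ q ─ p ∣ ≡ ∣ q ∣
∣p∣+∣q─p∣≡∣q∣ {p = p} {q} p⊆q =
  trans (sym (∣p∪q∣≡∣p∣+∣q∣ p (q ─ p) (Disjoint-─ q p))) (cong ∣_∣ (q∪p─q≡p p⊆q))

⊈⇒∃ : ∀ (p q : Subset n) → ¬ (p ⊆ q) → ∃[ i ] (i ∈ p × i ∉ q)
⊈⇒∃ p q p⊈q with nonempty? (p ─ q)
... | yes (i , i∈) = i , p─q⊆p p q i∈ , x∈p─q⇒x∉q p q i∈
... | no  empty    = ⊥-elim (p⊈q λ {i} i∈p → in-q i∈p (i ∈? q))
  where
  in-q : ∀ {i} → i ∈ p → Dec (i ∈ q) → i ∈ q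
  in-q i∈p (yes i∈q) = i∈q
  in-q i∈p (no  i∉q) = ⊥-elim (empty (_ , x∈p∧x∉q⇒x∈p─q i∈p i∉q))

filterˢ : {P : Fin n → Set} → Decidable P → Subset n
filterˢ P? = tabulate (does ∘ P?)

∈-filterˢ⁺ : ∀ {P : Fin n → Set} (P? : Decidable P) {i} → P i → i ∈ filterˢ P?
∈-filterˢ⁺ P? {i} p = lookup⇒[]= i _ (trans (lookup∘tabulate (does ∘ P?) i) true!)
  where
  true! : does (P? i) ≡ true
  true! with P? i
  ... | yes _ = refl
  ... | no ¬p = ⊥-elim (¬p p)

∈-filterˢ⁻ : ∀ {P : Fin n → Set} (P? : Decidable P) {i} → i ∈ filterˢ P? → P i
∈-filterˢ⁻ P? {i} i∈ with P? i | trans (sym (lookup∘tabulate (does ∘ P?) i)) ([]=⇒lookup i∈)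
... | yes p | _  = p
... | no  _ | ()

∈-⋃⁺ : ∀ {Ks : List (Subset n)} {i} → Any (i ∈_) Ks → i ∈ ⋃ Ks
∈-⋃⁺ (here i∈K)  = x∈p∪q⁺ (inj₁ i∈K)
∈-⋃⁺ (there i∈Ks) = x∈p∪q⁺ (inj₂ (∈-⋃⁺ i∈Ks))

∈-⋃⁻ : ∀ (Ks : List (Subset n)) {i} → i ∈ ⋃ Ks → Any (i ∈_) Ks
∈-⋃⁻ []       i∈ = ⊥-elim (∉⊥ i∈)
∈-⋃⁻ (K ∷ Ks) i∈ with x∈p∪q⁻ K (⋃ Ks) i∈
... | inj₁ i∈K  = here i∈K
... | inj₂ i∈Ks = there (∈-⋃⁻ Ks i∈Ks)

sumOver-cong : ∀ (A : Subset n) {x y} → (∀ i → i ∈ A → x i ≡ y i) → sumOver A x ≡ sumOver A y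
sumOver-cong []          h = refl
sumOver-cong (true  ∷ A) h = cong₂ _+_ (h zero here) (sumOver-cong A λ i i∈ → h (suc i) (there i∈))
sumOver-cong (false ∷ A) h = cong (0ℚ +_) (sumOver-cong A λ i i∈ → h (suc i) (there i∈))

+-interchange : ∀ p q r s → (p + q) + (r + s) ≡ (p + r) + (q + s)
+-interchange = solve 4 (λ p q r s → (p :+ q) :+ (r :+ s) := (p :+ r) :+ (q :+ s)) refl
  where open +-*-Solver

sumOver-+ : ∀ (A : Subset n) x y → sumOver A (λ i → x i + y i) ≡ sumOver A x + sumOver A y
sumOver-+ []          x y = refl
sumOver-+ (true  ∷ A) x y =
  trans (cong (x zero + y zero +_) (sumOver-+ A (x ∘ suc) (y ∘ suc)))
        (+-interchange (x zero) (y zero) (sumOver A (x ∘ suc)) (sumOver A (y ∘ suc)))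
sumOver-+ (false ∷ A) x y =
  trans (cong (0ℚ +_) (sumOver-+ A (x ∘ suc) (y ∘ suc)))
        (+-interchange 0ℚ 0ℚ (sumOver A (x ∘ suc)) (sumOver A (y ∘ suc)))

sumOver-* : ∀ (A : Subset n) k x → sumOver A (λ i → k * x i) ≡ k * sumOver A x
sumOver-* []          k x = sym (ℚ.*-zeroʳ k)
sumOver-* (true  ∷ A) k x =
  trans (cong (k * x zero +_) (sumOver-* A k (x ∘ suc)))
        (sym (ℚ.*-distribˡ-+ k (x zero) (sumOver A (x ∘ suc))))
sumOver-* (false ∷ A) k x =
  trans (cong₂ _+_ (sym (ℚ.*-zeroʳ k)) (sumOver-* A k (x ∘ suc)))
        (sym (ℚ.*-distribˡ-+ k 0ℚ (sumOver A (x ∘ suc))))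

sumOver-∪ : ∀ (A B : Subset n) x → Disjoint A B → sumOver (A ∪ B) x ≡ sumOver A x + sumOver B x
sumOver-∪ []      []      x d = refl
sumOver-∪ (a ∷ A) (b ∷ B) x d = trans
  (cong₂ _+_ (head-∪ a b d) (sumOver-∪ A B (x ∘ suc) λ i j → d (there i) (there j)))
  (+-interchange (if a then x zero else 0ℚ) (if b then x zero else 0ℚ)
    (sumOver A (x ∘ suc)) (sumOver B (x ∘ suc)))
  where
  head-∪ : ∀ a b → Disjoint (a ∷ A) (b ∷ B) →
    (if a ∨ b then x zero else 0ℚ) ≡ (if a then x zero else 0ℚ) + (if b then x zero else 0ℚ)
  head-∪ true  true  d = ⊥-elim (d here here)
  head-∪ true  false d = sym (ℚ.+-identityʳ (x zero))
  head-∪ false true  d = sym (ℚ.+-identityˡ (x zero))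
  head-∪ false false d = refl

sumOver-⊥ : ∀ (x : Point n) → sumOver ⊥ x ≡ 0ℚ
sumOver-⊥ {zero}  x = refl
sumOver-⊥ {suc n} x = trans (cong (0ℚ +_) (sumOver-⊥ {n} _)) refl

sumOver-vanish : ∀ (A : Subset n) {x} → (∀ i → i ∈ A → x i ≡ 0ℚ) → sumOver A x ≡ 0ℚ
sumOver-vanish []          h = refl
sumOver-vanish (true  ∷ A) h =
  trans (cong₂ _+_ (h zero here) (sumOver-vanish A λ i i∈ → h (suc i) (there i∈))) refl
sumOver-vanish (false ∷ A) h =
  trans (cong (0ℚ +_) (sumOver-vanish A λ i i∈ → h (suc i) (there i∈))) refl

sumOver-nonneg : ∀ (A : Subset n) {x} → (∀ i → 0ℚ ℚ.≤ x i) → 0ℚ ℚ.≤ sumOver A x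
sumOver-nonneg []          h = ℚ.≤-refl
sumOver-nonneg (true  ∷ A) h = ℚ.+-mono-≤ (h zero) (sumOver-nonneg A (h ∘ suc))
sumOver-nonneg (false ∷ A) h = ℚ.+-mono-≤ (ℚ.≤-refl {0ℚ}) (sumOver-nonneg A (h ∘ suc))

-- Arithmetic

ι : ℕ → ℚ
ι k = ℤ.+ k ℚ./ 1

-- `ι k` is normalised by a gcd and is stuck for a variable k, so identities about `ι` are checked
-- on unnormalised representatives.
toℚᵘ-ι : ∀ k → ℚ.toℚᵘ (ι k) ℚᵘ.≃ ℚᵘ.mkℚᵘ (ℤ.+ k) 0
toℚᵘ-ι k = ℚ.toℚᵘ-fromℚᵘ (ℚᵘ.mkℚᵘ (ℤ.+ k) 0)

ι-+ : ∀ a b → ι (a ℕ.+ b) ≡ ι a + ι b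
ι-+ a b = ℚ.toℚᵘ-injective (begin
  ℚ.toℚᵘ (ι (a ℕ.+ b))                     ≈⟨ toℚᵘ-ι (a ℕ.+ b) ⟩
  ℚᵘ.mkℚᵘ (ℤ.+ (a ℕ.+ b)) 0                  ≈⟨ ℚᵘ.*≡* (cong (ℤ._* ℤ.+ 1) (cong₂ ℤ._+_ (sym (ℤ.*-identityʳ (ℤ.+ a))) (sym (ℤ.*-identityʳ (ℤ.+ b))))) ⟩
  ℚᵘ.mkℚᵘ (ℤ.+ a) 0 ℚᵘ.+ ℚᵘ.mkℚᵘ (ℤ.+ b) 0     ≈⟨ ℚᵘ.+-cong (toℚᵘ-ι a) (toℚᵘ-ι b) ⟨
  ℚ.toℚᵘ (ι a) ℚᵘ.+ ℚ.toℚᵘ (ι b)           ≈⟨ ℚ.toℚᵘ-homo-+ (ι a) (ι b) ⟨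
  ℚ.toℚᵘ (ι a + ι b)                       ∎)
  where open ℚᵘ.≃-Reasoning

ι-* : ∀ a b → ι (a ℕ.* b) ≡ ι a * ι b
ι-* a b = ℚ.toℚᵘ-injective (begin
  ℚ.toℚᵘ (ι (a ℕ.* b))                     ≈⟨ toℚᵘ-ι (a ℕ.* b) ⟩
  ℚᵘ.mkℚᵘ (ℤ.+ (a ℕ.* b)) 0                  ≈⟨ ℚᵘ.*≡* (cong (ℤ._* ℤ.+ 1) (ℤ.pos-* a b)) ⟩
  ℚᵘ.mkℚᵘ (ℤ.+ a) 0 ℚᵘ.* ℚᵘ.mkℚᵘ (ℤ.+ b) 0     ≈⟨ ℚᵘ.*-cong (toℚᵘ-ι a) (toℚᵘ-ι b) ⟨
  ℚ.toℚᵘ (ι a) ℚᵘ.* ℚ.toℚᵘ (ι b)           ≈⟨ ℚ.toℚᵘ-homo-* (ι a) (ι b) ⟨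
  ℚ.toℚᵘ (ι a * ι b)                       ∎)
  where open ℚᵘ.≃-Reasoning

ι-mono-< : ∀ {a b} → a ℕ.< b → ι a ℚ.< ι b
ι-mono-< {a} {b} a<b = ℚ.toℚᵘ-cancel-<
  (ℚᵘ.<-respˡ-≃ (ℚᵘ.≃-sym (toℚᵘ-ι a)) (ℚᵘ.<-respʳ-≃ (ℚᵘ.≃-sym (toℚᵘ-ι b))
    (ℚᵘ.*<* (ℤ.*-monoʳ-<-pos (ℤ.+ 1) (ℤ.+<+ a<b)))))

-- Gives each element of a label its equal share of the excess; fractional coordinates enter here.
ι-divide : ∀ m k → 1 ℕ.≤ k → ∃[ w ] (0ℚ ℚ.≤ w × w * ι k ≡ ι m)
ι-divide m (suc k) _ = w , w≥0 , eq
  where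
  instance
    pos-k : ℚ.Positive (ι (suc k))
    pos-k = ℚ.normalize-pos (suc k) 1
    nz-k : ℚ.NonZero (ι (suc k))
    nz-k = ℚ.pos⇒nonZero (ι (suc k))
    inv-pos : ℚ.Positive (ℚ.1/ ι (suc k))
    inv-pos = ℚ.1/pos⇒pos (ι (suc k))
    inv-nn : ℚ.NonNegative (ℚ.1/ ι (suc k))
    inv-nn = ℚ.pos⇒nonNeg (ℚ.1/ ι (suc k))
    m-nn : ℚ.NonNegative (ι m)
    m-nn = ℚ.normalize-nonNeg m 1
  w : ℚ
  w = ι m * ℚ.1/ ι (suc k)
  w≥0 : 0ℚ ℚ.≤ w
  w≥0 = ℚ.nonNegative⁻¹ w {{ℚ.nonNeg*nonNeg⇒nonNeg (ι m) (ℚ.1/ ι (suc k))}}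
  eq : w * ι (suc k) ≡ ι m
  eq = trans (ℚ.*-assoc (ι m) _ _)
      (trans (cong (ι m *_) (ℚ.*-inverseˡ (ι (suc k)))) (ℚ.*-identityʳ (ι m)))

-- Bernoulli's inequality for 1 + 2. In `share-bound` it pays for the m = k - j elements of the
-- label that lie outside the set under comparison.
1+2m≤3^m : ∀ m → 1 ℕ.+ 2 ℕ.* m ℕ.≤ 3 ^ m
1+2m≤3^m zero    = s≤s z≤n
1+2m≤3^m (suc m) = begin
  1 ℕ.+ 2 ℕ.* suc m            ≤⟨ ℕ.m≤m+n _ (4 ℕ.* m) ⟩
  1 ℕ.+ 2 ℕ.* suc m ℕ.+ 4 ℕ.* m ≡⟨ lem m ⟩
  3 ℕ.* (1 ℕ.+ 2 ℕ.* m)        ≤⟨ ℕ.*-monoʳ-≤ 3 (1+2m≤3^m m) ⟩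
  3 ^ suc m                    ∎
  where
  open ℕ.≤-Reasoning
  lem : ∀ m → 1 ℕ.+ 2 ℕ.* suc m ℕ.+ 4 ℕ.* m ≡ 3 ℕ.* (1 ℕ.+ 2 ℕ.* m)
  lem = solve-∀

-- With a and b the next lower powers, 3a + 3b ≤ 6ab ≤ 9ab. Both exponents must be positive, as 1 +
-- 3^q exceeds 3^q. Iterated over the children of a node, this bounds their total mass by 3^r.
3^p+3^q≤3^[p+q] : ∀ {p q} → 1 ℕ.≤ p → 1 ℕ.≤ q → 3 ^ p ℕ.+ 3 ^ q ℕ.≤ 3 ^ (p ℕ.+ q)
3^p+3^q≤3^[p+q] {suc p} {suc q} _ _ = begin
  3 ^ suc p ℕ.+ 3 ^ suc q              ≤⟨ ℕ.+-mono-≤ (ℕ.m≤m*n (3 ^ suc p) (3 ^ q) {{ℕ.m^n≢0 3 q}}) (ℕ.m≤n*m (3 ^ suc q) (3 ^ p) {{ℕ.m^n≢0 3 p}}) ⟩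
  3 ^ suc p ℕ.* 3 ^ q ℕ.+ 3 ^ p ℕ.* 3 ^ suc q ≤⟨ ℕ.m≤m+n _ (3 ^ p ℕ.* 3 ^ suc q) ⟩
  3 ^ suc p ℕ.* 3 ^ q ℕ.+ 3 ^ p ℕ.* 3 ^ suc q ℕ.+ 3 ^ p ℕ.* 3 ^ suc q ≡⟨ lem (3 ^ p) (3 ^ q) ⟩
  3 ^ suc p ℕ.* 3 ^ suc q              ≡⟨ ℕ.^-distribˡ-+-* 3 (suc p) (suc q) ⟨
  3 ^ (suc p ℕ.+ suc q)                ∎
  where
  open ℕ.≤-Reasoning
  lem : ∀ a b → 3 ℕ.* a ℕ.* b ℕ.+ a ℕ.* (3 ℕ.* b) ℕ.+ a ℕ.* (3 ℕ.* b) ≡ 3 ℕ.* a ℕ.* (3 ℕ.* b)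
  lem = solve-∀

-- Each summand is at most a third of 3^a.
3^p+3^q<3^a : ∀ {p q a} → p ℕ.< a → q ℕ.< a → 3 ^ p ℕ.+ 3 ^ q ℕ.< 3 ^ a
3^p+3^q<3^a {p} {q} {suc a} (s≤s p≤a) (s≤s q≤a) = begin-strict
  3 ^ p ℕ.+ 3 ^ q             ≤⟨ ℕ.+-mono-≤ (ℕ.^-monoʳ-≤ 3 p≤a) (ℕ.^-monoʳ-≤ 3 q≤a) ⟩
  3 ^ a ℕ.+ 3 ^ a             <⟨ ℕ.m<m+n _ (ℕ.m^n>0 3 a) ⟩
  3 ^ a ℕ.+ 3 ^ a ℕ.+ 3 ^ a   ≡⟨ lem (3 ^ a) ⟩
  3 ^ suc a                   ∎
  where
  open ℕ.≤-Reasoning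
  lem : ∀ c → c ℕ.+ c ℕ.+ c ≡ 3 ℕ.* c
  lem = solve-∀

-- j shares out of k of the excess 3^(k+r) - 3^r outweigh 3^b, stated with k as common denominator.
share-bound : ∀ {j k b r} → 1 ℕ.≤ j → j ℕ.≤ k → b ℕ.≤ j ℕ.+ r → b ℕ.< k ℕ.+ r →
  k ℕ.* 3 ^ b ℕ.+ j ℕ.* 3 ^ r ℕ.< j ℕ.* 3 ^ (k ℕ.+ r)
share-bound {j} {k} {b} {r} 1≤j j≤k b≤ b< with ℕ.m≤n⇒∃[o]m+o≡n j≤k
-- j = k is the one case in which b ≤ j + r is too weak and b < k + r is used instead.
... | zero , refl = begin-strict
  (j ℕ.+ 0) ℕ.* 3 ^ b ℕ.+ j ℕ.* 3 ^ r   ≡⟨ lem j (3 ^ b) (3 ^ r) ⟩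
  j ℕ.* (3 ^ b ℕ.+ 3 ^ r)               <⟨ ℕ.*-monoʳ-< j {{ℕ.>-nonZero 1≤j}} (3^p+3^q<3^a b< (ℕ.+-monoˡ-≤ r (ℕ.≤-trans 1≤j j≤k))) ⟩
  j ℕ.* 3 ^ (j ℕ.+ 0 ℕ.+ r)             ∎
  where
  open ℕ.≤-Reasoning
  lem : ∀ j a b → (j ℕ.+ 0) ℕ.* a ℕ.+ j ℕ.* b ≡ j ℕ.* (a ℕ.+ b)
  lem = solve-∀
... | suc m , refl = begin-strict
  (j ℕ.+ suc m) ℕ.* 3 ^ b ℕ.+ j ℕ.* 3 ^ r
    ≤⟨ ℕ.+-monoˡ-≤ _ (ℕ.*-monoʳ-≤ (j ℕ.+ suc m) (ℕ.^-monoʳ-≤ 3 b≤)) ⟩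
  (j ℕ.+ suc m) ℕ.* 3 ^ (j ℕ.+ r) ℕ.+ j ℕ.* 3 ^ r
    <⟨ ℕ.+-monoʳ-< _ (ℕ.*-monoʳ-< j {{ℕ.>-nonZero 1≤j}} (ℕ.^-monoʳ-< 3 (s≤s (s≤s z≤n)) (ℕ.m<n+m r 1≤j))) ⟩
  (j ℕ.+ suc m) ℕ.* B ℕ.+ j ℕ.* B
    ≤⟨ ℕ.+-monoˡ-≤ _ (ℕ.*-monoˡ-≤ B (ℕ.+-monoʳ-≤ j (ℕ.m≤m+n (suc m) _))) ⟩
  -- Padding by (j - 1) * suc m turns suc m into j * suc m, so that a factor j can be pulled out.
  (j ℕ.+ (suc m ℕ.+ (j ℕ.∸ 1) ℕ.* suc m)) ℕ.* B ℕ.+ j ℕ.* B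
    ≡⟨ cong (λ z → (j ℕ.+ z) ℕ.* B ℕ.+ j ℕ.* B) (cong (ℕ._* suc m) (ℕ.m+[n∸m]≡n 1≤j)) ⟩
  (j ℕ.+ j ℕ.* suc m) ℕ.* B ℕ.+ j ℕ.* B
    ≤⟨ ℕ.m≤m+n _ (j ℕ.* m ℕ.* B) ⟩
  (j ℕ.+ j ℕ.* suc m) ℕ.* B ℕ.+ j ℕ.* B ℕ.+ j ℕ.* m ℕ.* B
    ≡⟨ lem j m B ⟩
  j ℕ.* ((1 ℕ.+ 2 ℕ.* suc m) ℕ.* B)
    ≤⟨ ℕ.*-monoʳ-≤ j (ℕ.*-monoˡ-≤ B (1+2m≤3^m (suc m))) ⟩
  j ℕ.* (3 ^ suc m ℕ.* B)
    ≡⟨ cong (j ℕ.*_) (ℕ.^-distribˡ-+-* 3 (suc m) (j ℕ.+ r)) ⟨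
  j ℕ.* 3 ^ (suc m ℕ.+ (j ℕ.+ r))
    ≡⟨ cong (λ z → j ℕ.* 3 ^ z) (lem₂ j m r) ⟩
  j ℕ.* 3 ^ (j ℕ.+ suc m ℕ.+ r) ∎
  where
  open ℕ.≤-Reasoning
  B = 3 ^ (j ℕ.+ r)
  lem : ∀ j m B → (j ℕ.+ j ℕ.* suc m) ℕ.* B ℕ.+ j ℕ.* B ℕ.+ j ℕ.* m ℕ.* B ≡ j ℕ.* ((1 ℕ.+ 2 ℕ.* suc m) ℕ.* B)
  lem = solve-∀
  lem₂ : ∀ j m r → suc m ℕ.+ (j ℕ.+ r) ≡ j ℕ.+ suc m ℕ.+ r
  lem₂ = solve-∀

Disjoint-sym : ∀ {p q : Subset n} → Disjoint p q → Disjoint q p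
Disjoint-sym d i∈q i∈p = d i∈p i∈q

Disjoint-⊆ : ∀ {p p′ q q′ : Subset n} → p ⊆ p′ → q ⊆ q′ → Disjoint p′ q′ → Disjoint p q
Disjoint-⊆ p⊆ q⊆ d i∈p i∈q = d (p⊆ i∈p) (q⊆ i∈q)

-- The order by least elements

least : ∀ {p : Subset n} → Nonempty p → ∃[ i ] (i ∈ p × (∀ j → j ∈ p → i Fin.≤ j))
least {p = true  ∷ p} _ = zero , here , λ _ _ → z≤n
least {p = false ∷ p} (suc i , there i∈p) with least (i , i∈p)
... | m , m∈p , min = suc m , there m∈p , λ { (suc j) (there j∈p) → s≤s (min j j∈p) }

MinBefore-asym : ∀ {p q : Subset n} → MinBefore p q → ¬ MinBefore q p
MinBefore-asym (i , i∈p , i<) (j , j∈q , j<) = ℕ.<-asym (i< j j∈q) (j< i i∈p)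

MinBefore-trans : ∀ {p q r : Subset n} → MinBefore p q → MinBefore q r → MinBefore p r
MinBefore-trans (i , i∈p , i<) (j , j∈q , j<) =
  i , i∈p , λ k k∈r → ℕ.<-trans (i< j j∈q) (j< k k∈r)

MinBefore-total : ∀ {p q : Subset n} → Nonempty p → Nonempty q → Disjoint p q →
  MinBefore p q ⊎ MinBefore q p
MinBefore-total p≢∅ q≢∅ d with least p≢∅ | least q≢∅
... | i , i∈p , i≤ | j , j∈q , j≤ with Fin.<-cmp i j
... | tri< i<j _ _  = inj₁ (i , i∈p , λ k k∈q → ℕ.<-≤-trans i<j (j≤ k k∈q))
... | tri≈ _ refl _ = ⊥-elim (d i∈p j∈q)
... | tri> _ _ j<i  = inj₂ (j , j∈q , λ k k∈p → ℕ.<-≤-trans j<i (i≤ k k∈p))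

module _ (f : A → Subset n) where

  -- Insertion sort. `MinBefore` is total only between non-empty disjoint sets, so these hypotheses
  -- travel with the list. The key `f` lets it sort trees by `up` as well as plain subsets.
  insert-sorted : ∀ x ys → Nonempty (f x) → All (Nonempty ∘ f) ys → All (Disjoint (f x) ∘ f) ys →
    AllPairs (MinBefore on f) ys → ∃[ zs ] (zs ↭ x ∷ ys × AllPairs (MinBefore on f) zs)
  insert-sorted x []       x≢∅ _ _ _ = x ∷ [] , ↭-refl , [] ∷ []
  insert-sorted x (y ∷ ys) x≢∅ (y≢∅ ∷ ys≢∅) (dy ∷ dys) (y<ys ∷ s) with MinBefore-total x≢∅ y≢∅ dy
  ... | inj₁ x<y = x ∷ y ∷ ys , ↭-refl , (x<y ∷ All.map (MinBefore-trans x<y) y<ys) ∷ y<ys ∷ s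
  ... | inj₂ y<x with insert-sorted x ys x≢∅ ys≢∅ dys s
  ...   | zs , zs↭ , s′ = y ∷ zs , ↭-trans (prep y zs↭) (swap y x ↭-refl) ,
                          All-resp-↭ (↭-sym zs↭) (y<x ∷ y<ys) ∷ s′

  sort-disjoint : ∀ xs → All (Nonempty ∘ f) xs → AllPairs (Disjoint on f) xs →
    ∃[ ys ] (ys ↭ xs × AllPairs (MinBefore on f) ys)
  sort-disjoint []       _ _ = [] , ↭-refl , []
  sort-disjoint (x ∷ xs) (x≢∅ ∷ xs≢∅) (d ∷ ds) with sort-disjoint xs xs≢∅ ds
  ... | ys , ys↭ , s with insert-sorted x ys x≢∅ (All-resp-↭ (↭-sym ys↭) xs≢∅) (All-resp-↭ (↭-sym ys↭) d) s
  ...   | zs , zs↭ , s′ = zs , ↭-trans zs↭ (prep x ys↭) , s′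

-- Were the heads different, each would occur later in the other list, and so each would precede the
-- other. Asymmetry also excludes repetitions, which lets the inclusions pass to the tails.
asym-sorted-unique : ∀ {R : A → A → Set} → (∀ {x y} → R x y → ¬ R y x) → ∀ {xs ys} →
  AllPairs R xs → AllPairs R ys → (∀ {z} → z ∈ˡ xs → z ∈ˡ ys) → (∀ {z} → z ∈ˡ ys → z ∈ˡ xs) → xs ≡ ys
asym-sorted-unique asym [] [] _ _ = refl
asym-sorted-unique asym [] (_ ∷ _) _ ⊇ with () ← ⊇ (here refl)
asym-sorted-unique asym (_ ∷ _) [] ⊆ _ with () ← ⊆ (here refl)
asym-sorted-unique {R = R} asym {x ∷ xs} {y ∷ ys} (x<xs ∷ s) (y<ys ∷ s′) xs⊆ ⊆xs =
  cong₂ _∷_ x≡y (asym-sorted-unique asym s s′ tail⊆ ⊆tail)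
  where
  x≡y : x ≡ y
  x≡y with xs⊆ (here refl) | ⊆xs (here refl)
  ... | here x≡y | _        = x≡y
  ... | there _  | here y≡x = sym y≡x
  ... | there x∈ | there y∈ = ⊥-elim (asym (All.lookup x<xs y∈) (All.lookup y<ys x∈))
  tail⊆ : ∀ {z} → z ∈ˡ xs → z ∈ˡ ys
  tail⊆ z∈ with xs⊆ (there z∈)
  ... | there z∈′ = z∈′
  ... | here refl = ⊥-elim (asym x<y x<y)
    where x<y = subst (λ x → R x y) x≡y (All.lookup x<xs z∈)
  ⊆tail : ∀ {z} → z ∈ˡ ys → z ∈ˡ xs
  ⊆tail z∈ with ⊆xs (there z∈)
  ... | there z∈′ = z∈′
  ... | here refl = ⊥-elim (asym y<x y<x)
    where y<x = subst (λ y → R y x) (sym x≡y) (All.lookup y<ys z∈)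

disjoint-unique : ∀ (f : A → Subset n) {xs x y i} → AllPairs (Disjoint on f) xs →
  x ∈ˡ xs → y ∈ˡ xs → i ∈ f x → i ∈ f y → x ≡ y
disjoint-unique f (d ∷ ds) (here refl) (here refl) i∈x i∈y = refl
disjoint-unique f (d ∷ ds) (here refl) (there y∈)  i∈x i∈y = ⊥-elim (All.lookup d y∈ i∈x i∈y)
disjoint-unique f (d ∷ ds) (there x∈)  (here refl) i∈x i∈y = ⊥-elim (All.lookup d x∈ i∈y i∈x)
disjoint-unique f (d ∷ ds) (there x∈)  (there y∈)  i∈x i∈y = disjoint-unique f ds x∈ y∈ i∈x i∈y

-- Connected components

module _ {n} (E : Hypergraph n) where

  -- Elementwise form of `IsComponents`: the equation for the union becomes `inside` and `cover`,
  -- which apply directly to membership proofs.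
  record Components (Z : Subset n) (Ks : List (Subset n)) : Set where
    field
      sat      : All (Sat E) Ks
      disjoint : AllPairs Disjoint Ks
      inside   : All (_⊆ Z) Ks
      cover    : ∀ {i} → i ∈ Z → Any (i ∈_) Ks
      edges    : ∀ {W} → Edge E W → W ⊆ Z → Any (W ⊆_) Ks

  open Components

  fromIsComponents : ∀ {Z Ks} → IsComponents E Z Ks → Components Z Ks
  fromIsComponents {Ks = Ks} (s , d , refl , e) = record
    { sat      = s
    ; disjoint = AllPairs.map ∩≡⊥⇒Disjoint d
    ; inside   = All.tabulate λ K∈ i∈K → ∈-⋃⁺ (lose K∈ i∈K)
    ; cover    = ∈-⋃⁻ Ks
    ; edges    = λ {W} → e W
    }

  toIsComponents : ∀ {Z Ks} → Components Z Ks → IsComponents E Z Ks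
  toIsComponents {Z} {Ks} c =
    sat c , AllPairs.map Disjoint⇒∩≡⊥ (disjoint c) ,
    ⊆-antisym (λ i∈ → let _ , K∈ , i∈K = find (∈-⋃⁻ Ks i∈) in All.lookup (inside c) K∈ i∈K)
              (∈-⋃⁺ ∘ cover c) ,
    λ _ → edges c

  Components-resp-↭ : ∀ {Z Ks Ls} → Ks ↭ Ls → Components Z Ks → Components Z Ls
  Components-resp-↭ p c = record
    { sat      = All-resp-↭ p (sat c)
    ; disjoint = ↭ₛ.AllPairs-resp-↭ (setoid _) Disjoint-sym ((λ { refl d → d }) , (λ { refl d → d })) (↭⇒↭ₛ p) (disjoint c)
    ; inside   = All-resp-↭ p (inside c)
    ; cover    = Any-resp-↭ p ∘ cover c
    ; edges    = λ w W⊆ → Any-resp-↭ p (edges c w W⊆)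
    }

  Crossing : Subset n → Subset n → Subset n → Subset n → Set
  Crossing X X₁ X₂ W = Edge E W × W ⊆ X × ¬ (W ⊆ X₁) × ¬ (W ⊆ X₂)

  crossing? : ∀ X X₁ X₂ → Dec (∃[ W ] Crossing X X₁ X₂ W)
  crossing? X X₁ X₂ = anySubset? λ W →
    (E W Bool.≟ true) ×-dec (W ⊆? X) ×-dec ¬? (W ⊆? X₁) ×-dec ¬? (W ⊆? X₂)

  -- The second part of a partition is the complement of the first, so one subset witnesses a
  -- failure of connectedness and a finite search decides it. When the search fails, deciding
  -- `Crossing` supplies the actual edge that `ConnectedHG` demands.
  Splits : Subset n → Subset n → Set
  Splits X X₁ = X₁ ⊆ X × Nonempty X₁ × Nonempty (X ─ X₁) × ¬ (∃[ W ] Crossing X X₁ (X ─ X₁) W)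

  splits? : ∀ X → Dec (∃[ X₁ ] Splits X X₁)
  splits? X = anySubset? λ X₁ →
    (X₁ ⊆? X) ×-dec nonempty? X₁ ×-dec nonempty? (X ─ X₁) ×-dec ¬? (crossing? X X₁ (X ─ X₁))

  unsplit⇒connected : ∀ {X} → ¬ (∃[ X₁ ] Splits X X₁) → ConnectedHG E X
  unsplit⇒connected {X} ¬split X₁ X₂ refl X₁∩X₂≡⊥ X₁≢∅ (i , i∈X₂)
    with crossing? X X₁ (X ─ X₁)
  ... | no ¬c = ⊥-elim (¬split (X₁ , p⊆p∪q X₂ , X₁≢∅ ,
                  (i , x∈p∧x∉q⇒x∈p─q (q⊆p∪q X₁ X₂ i∈X₂) (Disjoint-sym (∩≡⊥⇒Disjoint X₁∩X₂≡⊥) i∈X₂)) , ¬c))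
  ... | yes (W , e , W⊆X , W⊈X₁ , W⊈X─X₁) = W , e , W⊆X , W⊈X₁ , λ W⊆X₂ → W⊈X─X₁ λ j∈W →
                  x∈p∧x∉q⇒x∈p─q (W⊆X j∈W) (Disjoint-sym (∩≡⊥⇒Disjoint X₁∩X₂≡⊥) (W⊆X₂ j∈W))

  module _ (E⊥ : E ⊥ ≡ false) where

    edge-nonempty : ∀ {W} → Edge E W → Nonempty W
    edge-nonempty {W} e with nonempty? W
    ... | yes W≢∅ = W≢∅
    ... | no  W∅ with () ← trans (sym e) (trans (cong E (Empty-unique W∅)) E⊥)

    connected-within : ∀ {B} Ks → Sat E B → AllPairs Disjoint Ks → B ⊆ ⋃ Ks →
      (∀ {W} → Edge E W → W ⊆ B → Any (W ⊆_) Ks) → Any (B ⊆_) Ks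
    connected-within [] ((i , i∈B) , _) _ B⊆ _ = ⊥-elim (∉⊥ (B⊆ i∈B))
    connected-within {B} (K ∷ Ks) satB@(B≢∅ , conn) (d ∷ ds) B⊆ es
      with nonempty? (B ∩ K) | nonempty? (B ─ K)
    ... | no B∩K∅ | _ = there (connected-within Ks satB ds B⊆Ks es′)
      where
      B⊆Ks : B ⊆ ⋃ Ks
      B⊆Ks i∈B with x∈p∪q⁻ K (⋃ Ks) (B⊆ i∈B)
      ... | inj₁ i∈K  = ⊥-elim (B∩K∅ (_ , x∈p∩q⁺ (i∈B , i∈K)))
      ... | inj₂ i∈Ks = i∈Ks
      es′ : ∀ {W} → Edge E W → W ⊆ B → Any (W ⊆_) Ks
      es′ e W⊆B with es e W⊆B | edge-nonempty e
      -- An edge inside both B and K would be empty, hence the appeal to `edge-nonempty`.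
      ... | here W⊆K | i , i∈W = ⊥-elim (B∩K∅ (i , x∈p∩q⁺ (W⊆B i∈W , W⊆K i∈W)))
      ... | there a  | _       = a
    ... | yes _ | no B─K∅ = here B⊆K
      where
      B⊆K : B ⊆ K
      B⊆K {i} i∈B with i ∈? K
      ... | yes i∈K = i∈K
      ... | no  i∉K = ⊥-elim (B─K∅ (i , x∈p∧x∉q⇒x∈p─q i∈B i∉K))
    ... | yes ∩≢∅ | yes ─≢∅
      with conn (B ∩ K) (B ─ K) partition (Disjoint⇒∩≡⊥ disj) ∩≢∅ ─≢∅
      where
      disj : Disjoint (B ∩ K) (B ─ K)
      disj i∈∩ i∈─ = x∈p─q⇒x∉q B K i∈─ (p∩q⊆q B K i∈∩)
      from : B ⊆ (B ∩ K) ∪ (B ─ K)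
      from {i} i∈B with i ∈? K
      ... | yes i∈K = x∈p∪q⁺ (inj₁ (x∈p∩q⁺ (i∈B , i∈K)))
      ... | no  i∉K = x∈p∪q⁺ (inj₂ (x∈p∧x∉q⇒x∈p─q i∈B i∉K))
      to : (B ∩ K) ∪ (B ─ K) ⊆ B
      to i∈ with x∈p∪q⁻ (B ∩ K) (B ─ K) i∈
      ... | inj₁ i∈∩ = p∩q⊆p B K i∈∩
      ... | inj₂ i∈─ = p─q⊆p B K i∈─
      partition : (B ∩ K) ∪ (B ─ K) ≡ B
      partition = ⊆-antisym to from
    ... | W , e , W⊆B , W⊈∩ , W⊈─ with es e W⊆B
    ...   | here W⊆K = ⊥-elim (W⊈∩ λ i∈W → x∈p∩q⁺ (W⊆B i∈W , W⊆K i∈W))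
    ...   | there a  = ⊥-elim (W⊈─ λ i∈W → x∈p∧x∉q⇒x∈p─q (W⊆B i∈W) λ i∈K →
              let L , L∈ , W⊆L = find a in All.lookup d L∈ i∈K (W⊆L i∈W))

    sat-within : ∀ {Z Ks B} → Components Z Ks → Sat E B → B ⊆ Z → Any (B ⊆_) Ks
    sat-within {Ks = Ks} c satB B⊆Z =
      connected-within Ks satB (disjoint c) (∈-⋃⁺ ∘ cover c ∘ B⊆Z) (λ e W⊆B → edges c e (B⊆Z ∘ W⊆B))

    -- Two applications of `sat-within` give K ⊆ L ⊆ K′; K and K′ then share an element, so they
    -- coincide and K = L.
    components-⊆ : ∀ {Z Ks Ls} → Components Z Ks → Components Z Ls → ∀ {K} → K ∈ˡ Ks → K ∈ˡ Ls
    components-⊆ {Ks = Ks} {Ls} c c′ {K} K∈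
      with find (sat-within c′ (All.lookup (sat c) K∈) (All.lookup (inside c) K∈))
    ... | L , L∈ , K⊆L with find (sat-within c (All.lookup (sat c′) L∈) (All.lookup (inside c′) L∈))
    ...   | K′ , K′∈ , L⊆K′ with All.lookup (sat c) K∈
    ...     | (i , i∈K) , _ with disjoint-unique id (disjoint c) K∈ K′∈ i∈K (L⊆K′ (K⊆L i∈K))
    ...       | refl = subst (_∈ˡ Ls) (⊆-antisym L⊆K′ K⊆L) L∈

    components-unique : ∀ {Z Ks Ls} → Components Z Ks → Components Z Ls →
      AllPairs MinBefore Ks → AllPairs MinBefore Ls → Ks ≡ Ls
    components-unique c c′ s s′ =
      asym-sorted-unique MinBefore-asym s s′ (components-⊆ c c′) (components-⊆ c′ c)

    -- A partition that no edge crosses distributes the edges within Z over its two parts, so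
    -- splitting recursively ends in connected pieces.
    components : ∀ Z → ∃[ Ks ] Components Z Ks
    components Z = go Z (⊂-wellFounded Z)
      where
      go : ∀ Z → Acc _⊂_ Z → ∃[ Ks ] Components Z Ks
      go Z (acc rec) with nonempty? Z | splits? Z
      ... | no Z∅ | _ = [] , record
        { sat = [] ; disjoint = [] ; inside = []
        ; cover = λ i∈Z → ⊥-elim (Z∅ (_ , i∈Z))
        ; edges = λ e W⊆Z → let i , i∈W = edge-nonempty e in ⊥-elim (Z∅ (i , W⊆Z i∈W)) }
      ... | yes Z≢∅ | no ¬split = Z ∷ [] , record
        { sat = (Z≢∅ , unsplit⇒connected ¬split) ∷ [] ; disjoint = [] ∷ [] ; inside = id ∷ []
        ; cover = here ; edges = λ _ → here }
      ... | yes _ | yes (X , X⊆Z , (i , i∈X) , (j , j∈Z─X) , ¬cross)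
        with go X (rec (X⊆Z , j , p─q⊆p Z X j∈Z─X , x∈p─q⇒x∉q Z X j∈Z─X))
           | go (Z ─ X) (rec (p─q⊆p Z X , i , X⊆Z i∈X , Disjoint-─ Z X i∈X))
      ... | Ks , c | Ls , c′ = Ks ++ Ls , record
        { sat = All.++⁺ (sat c) (sat c′)
        ; disjoint = AllPairs.++⁺ (disjoint c) (disjoint c′)
            (All.tabulate λ K∈ → All.tabulate λ L∈ →
              Disjoint-⊆ (All.lookup (inside c) K∈) (All.lookup (inside c′) L∈) (Disjoint-─ Z X))
        ; inside = All.++⁺ (All.tabulate λ K∈ i∈K → X⊆Z (All.lookup (inside c) K∈ i∈K))
                           (All.tabulate λ L∈ i∈L → p─q⊆p Z X (All.lookup (inside c′) L∈ i∈L))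
        ; cover = cover′
        ; edges = edges′ }
        where
        cover′ : ∀ {i} → i ∈ Z → Any (i ∈_) (Ks ++ Ls)
        cover′ {i} i∈Z with i ∈? X
        ... | yes i∈X = Any.++⁺ˡ (cover c i∈X)
        ... | no  i∉X = Any.++⁺ʳ Ks (cover c′ (x∈p∧x∉q⇒x∈p─q i∈Z i∉X))
        edges′ : ∀ {W} → Edge E W → W ⊆ Z → Any (W ⊆_) (Ks ++ Ls)
        edges′ {W} e W⊆Z with W ⊆? X | W ⊆? (Z ─ X)
        ... | yes W⊆X | _         = Any.++⁺ˡ (edges c e W⊆X)
        ... | no _    | yes W⊆Z─X = Any.++⁺ʳ Ks (edges c′ e W⊆Z─X)
        ... | no W⊈X  | no W⊈Z─X  = ⊥-elim (¬cross (W , e , W⊆Z , W⊈X , W⊈Z─X))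

    sorted-components : ∀ Z → ∃[ Ks ] (Components Z Ks × AllPairs MinBefore Ks)
    sorted-components Z with components Z
    ... | Ks , c with sort-disjoint id Ks (All.map proj₁ (sat c)) (disjoint c)
    ...   | Ls , Ls↭Ks , s = Ls , Components-resp-↭ (↭-sym Ls↭Ks) c , s

-- Trees

-- Packages the mutual recursion on trees and lists of trees once; later inductions receive their
-- hypotheses as an `All`.
tree-ind : ∀ {n} {P : Tree n → Set} → (∀ {Y ts} → All P ts → P (node Y ts)) → ∀ t → P t
trees-ind : ∀ {n} {P : Tree n → Set} → (∀ {Y ts} → All P ts → P (node Y ts)) → ∀ ts → All P ts
tree-ind  step (node Y ts) = step (trees-ind step ts)
trees-ind step []       = []
trees-ind step (t ∷ ts) = tree-ind step t ∷ trees-ind step ts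

upList≡⋃ : ∀ (ts : List (Tree n)) → upList ts ≡ ⋃ (map up ts)
upList≡⋃ []       = refl
upList≡⋃ (t ∷ ts) = cong (up t ∪_) (upList≡⋃ ts)

up∈ψ : ∀ (t : Tree n) → up t ∈ˡ ψ t
up∈ψ (node Y ts) = here refl

∈-ψList⁺ : ∀ {ts : List (Tree n)} {B} → Any (λ t → B ∈ˡ ψ t) ts → B ∈ˡ ψList ts
∈-ψList⁺ (here {t} B∈) = ∈-++⁺ˡ B∈
∈-ψList⁺ (there {t} a) = ∈-++⁺ʳ (ψ t) (∈-ψList⁺ a)

∈-ψList⁻ : ∀ (ts : List (Tree n)) {B} → B ∈ˡ ψList ts → Any (λ t → B ∈ˡ ψ t) ts
∈-ψList⁻ (t ∷ ts) B∈ with ∈-++⁻ (ψ t) B∈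
... | inj₁ B∈t  = here B∈t
... | inj₂ B∈ts = there (∈-ψList⁻ ts B∈ts)

up⊆upList : ∀ {ts : List (Tree n)} {t} → t ∈ˡ ts → up t ⊆ upList ts
up⊆upList (here refl) i∈ = x∈p∪q⁺ (inj₁ i∈)
up⊆upList (there t∈)  i∈ = x∈p∪q⁺ (inj₂ (up⊆upList t∈ i∈))

ψ⇒⊆up : ∀ (t : Tree n) {B} → B ∈ˡ ψ t → B ⊆ up t
ψ⇒⊆up = tree-ind step
  where
  step : ∀ {Y ts} → All (λ t → ∀ {B} → B ∈ˡ ψ t → B ⊆ up t) ts →
    ∀ {B} → B ∈ˡ ψ (node Y ts) → B ⊆ up (node Y ts)
  step ih (here refl) i∈B = i∈B
  step {Y} {ts} ih (there B∈) i∈B with find (∈-ψList⁻ ts B∈)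
  ... | t , t∈ , B∈t = x∈p∪q⁺ (inj₂ (up⊆upList t∈ (All.lookup ih t∈ B∈t i∈B)))

module _ {n} {E : Hypergraph n} where

  up-construct : ∀ {X T} → Construct E X T → up T ≡ X
  upList-constructs : ∀ {Ks ts} → Pointwise (Construct E) Ks ts → map up ts ≡ Ks
  up-construct {X} (whole _) = ∪-identityʳ X
  up-construct {X} (graft {Y = Y} {Ks} {ts} _ (Y⊆X , _) (_ , _ , ⋃≡ , _) _ cs) = begin
    Y ∪ upList ts        ≡⟨ cong (Y ∪_) (upList≡⋃ ts) ⟩
    Y ∪ ⋃ (map up ts)    ≡⟨ cong (λ Ks → Y ∪ ⋃ Ks) (upList-constructs cs) ⟩
    Y ∪ ⋃ Ks             ≡⟨ cong (Y ∪_) ⋃≡ ⟩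
    Y ∪ (X ─ Y)          ≡⟨ q∪p─q≡p Y⊆X ⟩
    X                    ∎
    where open ≡-Reasoning
  upList-constructs []       = refl
  upList-constructs (c ∷ cs) = cong₂ _∷_ (up-construct c) (upList-constructs cs)

  constructs-up : ∀ {Ks ts} → Pointwise (Construct E) Ks ts → All (λ t → Construct E (up t) t) ts
  constructs-up []       = []
  constructs-up (_∷_ {y = t} c cs) = subst (λ K → Construct E K t) (sym (up-construct c)) c ∷ constructs-up cs

-- The uniform view of a construct: leaves are nodes without components, and the
-- components are read off the subtrees.
record Node {n} (E : Hypergraph n) (X Y : Subset n) (ts : List (Tree n)) : Set where
  field
    root≢∅     : Nonempty Y
    root⊆      : Y ⊆ X
    comps      : Components E (X ─ Y) (map up ts)
    sorted     : AllPairs MinBefore (map up ts)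
    constructs : All (λ t → Construct E (up t) t) ts

  open Components comps public

  child⊆X─Y : ∀ {t} → t ∈ˡ ts → up t ⊆ X ─ Y
  child⊆X─Y t∈ = All.lookup inside (∈-map⁺ up t∈)

  child-disjoint-root : ∀ {t} → t ∈ˡ ts → Disjoint Y (up t)
  child-disjoint-root t∈ i∈Y i∈t = Disjoint-─ X Y i∈Y (child⊆X─Y t∈ i∈t)

  child-sat : ∀ {t} → t ∈ˡ ts → Sat E (up t)
  child-sat t∈ = All.lookup sat (∈-map⁺ up t∈)

  children-disjoint : AllPairs (Disjoint on up) ts
  children-disjoint = AllPairs.map⁻ disjoint

  child-cover : ∀ {i} → i ∈ X → i ∉ Y → ∃[ t ] (t ∈ˡ ts × i ∈ up t)
  child-cover i∈X i∉Y = find (Any.map⁻ (cover (x∈p∧x∉q⇒x∈p─q i∈X i∉Y)))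

  up≡ : up (node Y ts) ≡ X
  up≡ = trans (cong (Y ∪_) (trans (upList≡⋃ ts) (proj₁ (proj₂ (proj₂ (toIsComponents E comps))))))
              (q∪p─q≡p root⊆)

module _ {n} {E : Hypergraph n} (E⊥ : E ⊥ ≡ false) where

  open Node

  view : ∀ {X Y ts} → Construct E X (node Y ts) → Node E X Y ts
  view {X} (whole X≢∅) = record
    { root≢∅ = X≢∅ ; root⊆ = id ; sorted = [] ; constructs = []
    ; comps = record
      { sat = [] ; disjoint = [] ; inside = []
      ; cover = λ i∈ → ⊥-elim (x∈p─q⇒x∉q X X i∈ (p─q⊆p X X i∈))
      ; edges = λ e W⊆ → let i , i∈W = edge-nonempty E E⊥ e in
                  ⊥-elim (x∈p─q⇒x∉q X X (W⊆ i∈W) (p─q⊆p X X (W⊆ i∈W))) } }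
  view {X} {Y} (graft Y≢∅ (Y⊆X , _) c s cs) with upList-constructs cs
  ... | refl = record
    { root≢∅ = Y≢∅ ; root⊆ = Y⊆X ; comps = fromIsComponents E c ; sorted = s
    ; constructs = constructs-up cs }

  -- Without subtrees `cover` leaves no element of X outside Y, so `whole` applies; with a subtree,
  -- an element of it shows that Y is proper.
  unview : ∀ {X Y ts} → Node E X Y ts → Construct E X (node Y ts)
  unview {X} {Y} {[]} v = subst (λ Y → Construct E X (node Y [])) (sym Y≡X) (whole (subst Nonempty Y≡X (root≢∅ v)))
    where
    X⊆Y : X ⊆ Y
    X⊆Y {i} i∈X with i ∈? Y
    ... | yes i∈Y = i∈Y
    ... | no  i∉Y with () ← proj₁ (proj₂ (child-cover v i∈X i∉Y))
    Y≡X : Y ≡ X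
    Y≡X = ⊆-antisym (root⊆ v) X⊆Y
  unview {X} {Y} {t ∷ ts} v with child-sat v (here refl)
  ... | (i , i∈t) , _ = graft (root≢∅ v)
        (root⊆ v , i , p─q⊆p X Y (child⊆X─Y v (here refl) i∈t) , x∈p─q⇒x∉q X Y (child⊆X─Y v (here refl) i∈t))
        (toIsComponents E (comps v)) (sorted v) (pointwise (constructs v))
    where
    pointwise : ∀ {ts} → All (λ t → Construct E (up t) t) ts → Pointwise (Construct E) (map up ts) ts
    pointwise []       = []
    pointwise (c ∷ cs) = c ∷ pointwise cs

  ψ-sat : ∀ T {X} → Construct E X T → Sat E X → All (Sat E) (ψ T)
  ψ-sat = tree-ind step
    where
    step : ∀ {Y ts} → All (λ t → ∀ {X} → Construct E X t → Sat E X → All (Sat E) (ψ t)) ts →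
      ∀ {X} → Construct E X (node Y ts) → Sat E X → All (Sat E) (ψ (node Y ts))
    step {Y} {ts} ih c satX = subst (Sat E) (sym (up≡ v)) satX ∷ All.tabulate λ B∈ →
      let t , t∈ , B∈t = find (∈-ψList⁻ ts B∈)
      in All.lookup (All.lookup ih t∈ (All.lookup (constructs v) t∈) (child-sat v t∈)) B∈t
      where v = view c

-- Generic points of Π(ψ(T))

const-on : Subset n → ℚ → Point n
const-on B w i = if lookup B i then w else 0ℚ

const-on-nonneg : ∀ (B : Subset n) {w} → 0ℚ ℚ.≤ w → ∀ i → 0ℚ ℚ.≤ const-on B w i
const-on-nonneg B w≥0 i with lookup B i
... | true  = w≥0
... | false = ℚ.≤-refl

const-on-∉ : ∀ (B : Subset n) {w i} → i ∉ B → const-on B w i ≡ 0ℚ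
const-on-∉ (true  ∷ B) {i = zero}  i∉B = ⊥-elim (i∉B here)
const-on-∉ (false ∷ B) {i = zero}  i∉B = refl
const-on-∉ (b     ∷ B) {i = suc i} i∉B = const-on-∉ B (i∉B ∘ there)

sumOver-const-on : ∀ (A B : Subset n) w → sumOver A (const-on B w) ≡ w * ι ∣ A ∩ B ∣
sumOver-const-on []          []          w = sym (ℚ.*-zeroʳ w)
sumOver-const-on (true  ∷ A) (true  ∷ B) w = begin
  w + sumOver A (const-on B w)   ≡⟨ cong₂ _+_ (sym (ℚ.*-identityʳ w)) (sumOver-const-on A B w) ⟩
  w * 1ℚ + w * ι ∣ A ∩ B ∣       ≡⟨ ℚ.*-distribˡ-+ w 1ℚ (ι ∣ A ∩ B ∣) ⟨
  w * (1ℚ + ι ∣ A ∩ B ∣)         ≡⟨ cong (w *_) (ι-+ 1 ∣ A ∩ B ∣) ⟨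
  w * ι (ℕ.suc ∣ A ∩ B ∣)        ∎
  where open ≡-Reasoning
sumOver-const-on (true  ∷ A) (false ∷ B) w = trans (ℚ.+-identityˡ _) (sumOver-const-on A B w)
sumOver-const-on (false ∷ A) (_     ∷ B) w = trans (ℚ.+-identityˡ _) (sumOver-const-on A B w)

∣p∩q∣≡0 : ∀ {p q : Subset n} → Disjoint p q → ∣ p ∩ q ∣ ≡ 0
∣p∩q∣≡0 {n} d = trans (cong ∣_∣ (Disjoint⇒∩≡⊥ d)) (∣⊥∣≡0 n)

p∩q≡q : ∀ {p q : Subset n} → q ⊆ p → p ∩ q ≡ q
p∩q≡q {p = p} {q} q⊆p = ⊆-antisym (p∩q⊆q p q) λ i∈q → x∈p∩q⁺ (q⊆p i∈q , i∈q)

module _ {n} (E : Hypergraph n) where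

  -- `support` keeps points of disjoint subtrees from disturbing each other's sums. `nonneg` permits
  -- discarding the subtrees' contribution when a set meeting the root label is bounded from below.
  record GenericPoint (X : Subset n) (M : List (Subset n)) : Set where
    field
      point   : Point n
      nonneg  : ∀ i → 0ℚ ℚ.≤ point i
      support : ∀ {i} → i ∉ X → point i ≡ 0ℚ
      tight   : All (λ A → πeq A point) M
      strict  : ∀ {B} → Sat E B → B ⊆ X → B ∈ˡ M ⊎ three^ ∣ B ∣ ℚ.< sumOver B point

  -- The mass is recorded as a natural number `N`. `N≡0⊎` singles out the empty forest, where `N≤`
  -- alone would allow N = 1 and the bound would fail after adding a tree.
  record GenericSum (ts : List (Tree n)) : Set where
    field
      point   : Point n
      nonneg  : ∀ i → 0ℚ ℚ.≤ point i
      support : ∀ {i} → i ∉ upList ts → point i ≡ 0ℚ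
      tight   : All (λ A → πeq A point) (ψList ts)
      strict  : ∀ {t B} → t ∈ˡ ts → Sat E B → B ⊆ up t →
                  B ∈ˡ ψ t ⊎ three^ ∣ B ∣ ℚ.< sumOver B point
      N       : ℕ
      mass    : sumOver (upList ts) point ≡ ι N
      N≤      : N ℕ.≤ 3 ^ ∣ upList ts ∣
      N≡0⊎    : N ≡ 0 ⊎ 1 ℕ.≤ ∣ upList ts ∣

  generic-sum : ∀ ts → All (λ t → Nonempty (up t)) ts → AllPairs (Disjoint on up) ts →
    All (λ t → GenericPoint (up t) (ψ t)) ts → GenericSum ts
  generic-sum [] _ _ _ = record
    { point = λ _ → 0ℚ ; nonneg = λ _ → ℚ.≤-refl ; support = λ _ → refl ; tight = []
    ; strict = λ () ; N = 0 ; mass = sumOver-⊥ {n} _ ; N≤ = z≤n ; N≡0⊎ = inj₁ refl }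
  generic-sum (t ∷ ts) (t≢∅ ∷ ts≢∅) (d ∷ ds) (g ∷ gs) = record
    { point   = λ i → G.point i + S.point i
    ; nonneg  = λ i → ℚ.+-mono-≤ (G.nonneg i) (S.nonneg i)
    ; support = λ i∉ → cong₂ _+_ (G.support (i∉ ∘ x∈p∪q⁺ ∘ inj₁)) (S.support (i∉ ∘ x∈p∪q⁺ ∘ inj₂))
    ; tight   = All.++⁺ (All.tabulate λ A∈ → trans (on-head (ψ⇒⊆up t A∈)) (All.lookup G.tight A∈))
                        (All.tabulate λ {A} A∈ → trans (on-tail (ψList⇒⊆ A∈)) (All.lookup S.tight A∈))
    ; strict  = λ
        { (here refl) satB B⊆ → Sum.map₂ (subst (_ ℚ.<_) (sym (on-head B⊆))) (G.strict satB B⊆)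
        ; (there t∈)  satB B⊆ → Sum.map₂ (subst (_ ℚ.<_) (sym (on-tail (up⊆upList t∈ ∘ B⊆)))) (S.strict t∈ satB B⊆) }
    ; N       = 3 ^ ∣ up t ∣ ℕ.+ S.N
    ; mass    = trans (sumOver-∪ (up t) (upList ts) _ disj)
               (trans (cong₂ _+_ (trans (on-head id) (All.lookup G.tight (up∈ψ t))) (trans (on-tail id) S.mass))
                      (sym (ι-+ (3 ^ ∣ up t ∣) S.N)))
    ; N≤      = subst (λ c → 3 ^ ∣ up t ∣ ℕ.+ S.N ℕ.≤ 3 ^ c) (sym ∣∪∣) (N-bound S.N≡0⊎)
    ; N≡0⊎    = inj₂ (subst (1 ℕ.≤_) (sym ∣∪∣) (ℕ.≤-trans (∣p∣>0 t≢∅) (ℕ.m≤m+n ∣ up t ∣ _)))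
    }
    where
    module G = GenericPoint g
    module S = GenericSum (generic-sum ts ts≢∅ ds gs)
    disj : Disjoint (up t) (upList ts)
    disj i∈t i∈ts with find (∈-⋃⁻ (map up ts) (subst (_ ∈_) (upList≡⋃ ts) i∈ts))
    ... | _ , K∈ , i∈K = All.lookup (All.map⁺ {P = Disjoint (up t)} d) K∈ i∈t i∈K
    ψList⇒⊆ : ∀ {A} → A ∈ˡ ψList ts → A ⊆ upList ts
    ψList⇒⊆ A∈ i∈A with find (∈-ψList⁻ ts A∈)
    ... | s , s∈ , A∈s = up⊆upList s∈ (ψ⇒⊆up s A∈s i∈A)
    on-head : ∀ {A} → A ⊆ up t → sumOver A (λ i → G.point i + S.point i) ≡ sumOver A G.point
    on-head {A} A⊆ = sumOver-cong A λ i i∈A →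
      trans (cong (G.point i +_) (S.support (disj (A⊆ i∈A)))) (ℚ.+-identityʳ _)
    on-tail : ∀ {A} → A ⊆ upList ts → sumOver A (λ i → G.point i + S.point i) ≡ sumOver A S.point
    on-tail {A} A⊆ = sumOver-cong A λ i i∈A →
      trans (cong (_+ S.point i) (G.support λ i∈t → disj i∈t (A⊆ i∈A))) (ℚ.+-identityˡ _)
    ∣∪∣ : ∣ up t ∪ upList ts ∣ ≡ ∣ up t ∣ ℕ.+ ∣ upList ts ∣
    ∣∪∣ = ∣p∪q∣≡∣p∣+∣q∣ (up t) (upList ts) disj
    N-bound : S.N ≡ 0 ⊎ 1 ℕ.≤ ∣ upList ts ∣ → 3 ^ ∣ up t ∣ ℕ.+ S.N ℕ.≤ 3 ^ (∣ up t ∣ ℕ.+ ∣ upList ts ∣)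
    N-bound (inj₁ N≡0) = subst (λ N → 3 ^ ∣ up t ∣ ℕ.+ N ℕ.≤ _) (sym N≡0)
      (ℕ.≤-trans (ℕ.≤-reflexive (ℕ.+-identityʳ _)) (ℕ.^-monoʳ-≤ 3 (ℕ.m≤m+n ∣ up t ∣ _)))
    N-bound (inj₂ q≥1) = ℕ.≤-trans (ℕ.+-monoʳ-≤ (3 ^ ∣ up t ∣) S.N≤) (3^p+3^q≤3^[p+q] {∣ up t ∣} {∣ upList ts ∣} (∣p∣>0 t≢∅) q≥1)

  module _ (E⊥ : E ⊥ ≡ false) where

    -- A connected B that misses Y lies below a single child, where the point of that child decides.
    -- If B meets Y without being X, its shares of the excess alone already exceed 3^|B|.
    generic-node : ∀ {X Y ts} → Node E X Y ts → GenericSum ts → GenericPoint X (ψ (node Y ts))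
    generic-node {X} {Y} {ts} v s = record
      { point   = x
      ; nonneg  = λ i → ℚ.+-mono-≤ (S.nonneg i) (const-on-nonneg Y w≥0 i)
      ; support = λ i∉X → cong₂ _+_ (S.support λ i∈ → i∉X (p─q⊆p X Y (subst (_ ∈_) up≡X─Y i∈)))
                                    (const-on-∉ Y (i∉X ∘ V.root⊆))
      ; tight   = subst (λ A → πeq A x) (sym V.up≡) tight-X ∷ All.tabulate tight-ψ
      ; strict  = λ {B} satB B⊆X → strict satB B⊆X (nonempty? (B ∩ Y)) (X ⊆? B)
      }
      where
      module V = Node v
      module S = GenericSum s
      k = ∣ Y ∣
      r = ∣ X ─ Y ∣
      1≤k : 1 ℕ.≤ k
      1≤k = ∣p∣>0 V.root≢∅
      k+r≡∣X∣ : k ℕ.+ r ≡ ∣ X ∣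
      k+r≡∣X∣ = ∣p∣+∣q─p∣≡∣q∣ V.root⊆
      -- The truncated subtraction is exact, by `N≤3^∣X∣`.
      excess : ℕ
      excess = 3 ^ ∣ X ∣ ℕ.∸ S.N
      up≡X─Y : upList ts ≡ X ─ Y
      up≡X─Y = trans (upList≡⋃ ts) (proj₁ (proj₂ (proj₂ (toIsComponents E V.comps))))
      N≤3^r : S.N ℕ.≤ 3 ^ r
      N≤3^r = subst (λ A → S.N ℕ.≤ 3 ^ ∣ A ∣) up≡X─Y S.N≤
      N≤3^∣X∣ : S.N ℕ.≤ 3 ^ ∣ X ∣
      N≤3^∣X∣ = ℕ.≤-trans N≤3^r (ℕ.^-monoʳ-≤ 3 (∣p─q∣≤∣p∣ X Y))
      weight : ∃[ w ] (0ℚ ℚ.≤ w × w * ι k ≡ ι excess)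
      weight = ι-divide excess k 1≤k
      w = proj₁ weight
      w≥0 = proj₁ (proj₂ weight)
      wk≡ = proj₂ (proj₂ weight)
      x : Point n
      x i = S.point i + const-on Y w i
      x-sum : ∀ A → sumOver A x ≡ sumOver A S.point + w * ι ∣ A ∩ Y ∣
      x-sum A = trans (sumOver-+ A S.point (const-on Y w))
                      (cong (sumOver A S.point +_) (sumOver-const-on A Y w))
      x-off-root : ∀ {A} → Disjoint A Y → sumOver A x ≡ sumOver A S.point
      x-off-root {A} d = begin
        sumOver A x                            ≡⟨ x-sum A ⟩
        sumOver A S.point + w * ι ∣ A ∩ Y ∣    ≡⟨ cong (λ c → sumOver A S.point + w * ι c) (∣p∩q∣≡0 d) ⟩
        sumOver A S.point + w * 0ℚ             ≡⟨ cong (sumOver A S.point +_) (ℚ.*-zeroʳ w) ⟩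
        sumOver A S.point + 0ℚ                 ≡⟨ ℚ.+-identityʳ _ ⟩
        sumOver A S.point                      ∎
        where open ≡-Reasoning
      S-on-X : sumOver X S.point ≡ ι S.N
      S-on-X = begin
        sumOver X S.point                               ≡⟨ cong (λ A → sumOver A S.point) (q∪p─q≡p V.root⊆) ⟨
        sumOver (Y ∪ (X ─ Y)) S.point                   ≡⟨ sumOver-∪ Y (X ─ Y) S.point (Disjoint-─ X Y) ⟩
        sumOver Y S.point + sumOver (X ─ Y) S.point
          ≡⟨ cong₂ _+_ (sumOver-vanish Y λ i i∈Y → S.support λ i∈ → Disjoint-─ X Y i∈Y (subst (i ∈_) up≡X─Y i∈))
                       (trans (cong (λ A → sumOver A S.point) (sym up≡X─Y)) S.mass) ⟩
        0ℚ + ι S.N                                      ≡⟨ ℚ.+-identityˡ _ ⟩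
        ι S.N                                           ∎
        where open ≡-Reasoning
      tight-X : πeq X x
      tight-X = begin
        sumOver X x                            ≡⟨ x-sum X ⟩
        sumOver X S.point + w * ι ∣ X ∩ Y ∣    ≡⟨ cong₂ _+_ S-on-X (cong (λ A → w * ι ∣ A ∣) (p∩q≡q V.root⊆)) ⟩
        ι S.N + w * ι k                        ≡⟨ cong (ι S.N +_) wk≡ ⟩
        ι S.N + ι excess                       ≡⟨ ι-+ S.N excess ⟨
        ι (S.N ℕ.+ excess)                     ≡⟨ cong ι (ℕ.m+[n∸m]≡n N≤3^∣X∣) ⟩
        three^ ∣ X ∣                           ∎
        where open ≡-Reasoning
      tight-ψ : ∀ {A} → A ∈ˡ ψList ts → πeq A x
      tight-ψ {A} A∈ with find (∈-ψList⁻ ts A∈)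
      ... | t , t∈ , A∈t = trans
        (x-off-root λ i∈A i∈Y → V.child-disjoint-root t∈ i∈Y (ψ⇒⊆up t A∈t i∈A))
        (All.lookup S.tight A∈)
      share-ℕ : ∀ {j b} → 1 ℕ.≤ j → j ℕ.≤ k → b ℕ.≤ j ℕ.+ r → b ℕ.< k ℕ.+ r → k ℕ.* 3 ^ b ℕ.< j ℕ.* excess
      share-ℕ {j} {b} 1≤j j≤k b≤ b< = ℕ.+-cancelʳ-< (j ℕ.* 3 ^ r) _ _ (begin-strict
        k ℕ.* 3 ^ b ℕ.+ j ℕ.* 3 ^ r        <⟨ share-bound 1≤j j≤k b≤ b< ⟩
        j ℕ.* 3 ^ (k ℕ.+ r)                ≡⟨ cong (λ c → j ℕ.* 3 ^ c) k+r≡∣X∣ ⟩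
        j ℕ.* 3 ^ ∣ X ∣                    ≡⟨ cong (j ℕ.*_) (ℕ.m∸n+n≡m N≤3^∣X∣) ⟨
        j ℕ.* (excess ℕ.+ S.N)             ≡⟨ ℕ.*-distribˡ-+ j excess S.N ⟩
        j ℕ.* excess ℕ.+ j ℕ.* S.N         ≤⟨ ℕ.+-monoʳ-≤ (j ℕ.* excess) (ℕ.*-monoʳ-≤ j N≤3^r) ⟩
        j ℕ.* excess ℕ.+ j ℕ.* 3 ^ r       ∎)
        where open ℕ.≤-Reasoning
      share : ∀ {j b} → 1 ℕ.≤ j → j ℕ.≤ k → b ℕ.≤ j ℕ.+ r → b ℕ.< k ℕ.+ r → three^ b ℚ.< w * ι j
      -- Multiplying by k clears the denominator of w.
      share {j} {b} 1≤j j≤k b≤ b< = ℚ.*-cancelˡ-<-nonNeg (ι k) {{ℚ.normalize-nonNeg k 1}} (begin-strict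
        ι k * ι (3 ^ b)      ≡⟨ ι-* k (3 ^ b) ⟨
        ι (k ℕ.* 3 ^ b)      <⟨ ι-mono-< (share-ℕ 1≤j j≤k b≤ b<) ⟩
        ι (j ℕ.* excess)     ≡⟨ ι-* j excess ⟩
        ι j * ι excess       ≡⟨ cong (ι j *_) wk≡ ⟨
        ι j * (w * ι k)      ≡⟨ rearrange (ι j) w (ι k) ⟩
        ι k * (w * ι j)      ∎)
        where
        open ℚ.≤-Reasoning
        rearrange : ∀ a b c → a * (b * c) ≡ c * (b * a)
        rearrange = solve 3 (λ a b c → a :* (b :* c) := c :* (b :* a)) refl
          where open +-*-Solver
      strict : ∀ {B} → Sat E B → B ⊆ X → Dec (Nonempty (B ∩ Y)) → Dec (X ⊆ B) →
        B ∈ˡ ψ (node Y ts) ⊎ three^ ∣ B ∣ ℚ.< sumOver B x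
      strict {B} satB B⊆X (no B∩Y∅) _
        with find (Any.map⁻ (sat-within E E⊥ V.comps satB B⊆X─Y))
        where
        B⊆X─Y : B ⊆ X ─ Y
        B⊆X─Y i∈B = x∈p∧x∉q⇒x∈p─q (B⊆X i∈B) λ i∈Y → B∩Y∅ (_ , x∈p∩q⁺ (i∈B , i∈Y))
      ... | t , t∈ , B⊆t = Sum.map (λ B∈ → there (∈-ψList⁺ (lose t∈ B∈)))
        (subst (three^ ∣ B ∣ ℚ.<_) (sym (x-off-root λ i∈B i∈Y → V.child-disjoint-root t∈ i∈Y (B⊆t i∈B))))
        (S.strict t∈ satB B⊆t)
      strict {B} satB B⊆X (yes _) (yes X⊆B) = inj₁ (here (trans (⊆-antisym B⊆X X⊆B) (sym V.up≡)))
      strict {B} satB B⊆X (yes B∩Y≢∅) (no X⊈B) = inj₂ (begin-strict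
        three^ ∣ B ∣                             <⟨ share (∣p∣>0 B∩Y≢∅) (∣p∩q∣≤∣q∣ B Y) ∣B∣≤ ∣B∣< ⟩
        w * ι ∣ B ∩ Y ∣                          ≡⟨ ℚ.+-identityˡ _ ⟨
        0ℚ + w * ι ∣ B ∩ Y ∣                     ≤⟨ ℚ.+-monoˡ-≤ (w * ι ∣ B ∩ Y ∣) (sumOver-nonneg B S.nonneg) ⟩
        sumOver B S.point + w * ι ∣ B ∩ Y ∣      ≡⟨ x-sum B ⟨
        sumOver B x                              ∎)
        where
        open ℚ.≤-Reasoning
        B⊂X : B ⊂ X
        B⊂X = B⊆X , ⊈⇒∃ X B X⊈B
        ∣B∣< : ∣ B ∣ ℕ.< k ℕ.+ r
        ∣B∣< = subst (∣ B ∣ ℕ.<_) (sym k+r≡∣X∣) (p⊂q⇒∣p∣<∣q∣ B⊂X)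
        ∣B∣≤ : ∣ B ∣ ℕ.≤ ∣ B ∩ Y ∣ ℕ.+ r
        ∣B∣≤ = ℕ.≤-trans (ℕ.≤-reflexive (sym (∣p∣+∣q─p∣≡∣q∣ (p∩q⊆p B Y))))
          (ℕ.+-monoʳ-≤ ∣ B ∩ Y ∣ (p⊆q⇒∣p∣≤∣q∣ λ i∈ → x∈p∧x∉q⇒x∈p─q (B⊆X (p─q⊆p B (B ∩ Y) i∈))
            λ i∈Y → x∈p─q⇒x∉q B (B ∩ Y) i∈ (x∈p∩q⁺ (p─q⊆p B (B ∩ Y) i∈ , i∈Y))))

    generic-point : ∀ T {X} → Construct E X T → GenericPoint X (ψ T)
    generic-point = tree-ind λ {Y} {ts} ih c → let v = view E⊥ c in
      generic-node v (generic-sum ts (All.tabulate λ t∈ → proj₁ (Node.child-sat v t∈))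
        (Node.children-disjoint v)
        (All.tabulate λ t∈ → All.lookup ih t∈ (All.lookup (Node.constructs v) t∈)))

-- The order on constructs

_⊆ψ_ : Tree n → Tree n → Set
T ⊆ψ S = ∀ {A} → A ∈ˡ ψ T → A ∈ˡ ψ S

upList-child : ∀ (ts₁ : List (Tree n)) {t t′ ts₂} → up t ≡ up t′ →
  upList (ts₁ ++ t ∷ ts₂) ≡ upList (ts₁ ++ t′ ∷ ts₂)
upList-child []        {ts₂ = ts₂} e = cong (_∪ upList ts₂) e
upList-child (t₁ ∷ ts₁) e = cong (up t₁ ∪_) (upList-child ts₁ e)

-- A merge only deletes the set of the absorbed child. The equality of tops is carried along for
-- `≤-child`, where changing a subtree must leave the set of the root as it is.
≤⇒⊆ψ : ∀ {E : Hypergraph n} {X S T} → S ≤[ E ∣ X ] T → up S ≡ up T × T ⊆ψ S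
≤⇒⊆ψ ≤-refl = refl , id
≤⇒⊆ψ (≤-trans p q) with ≤⇒⊆ψ p | ≤⇒⊆ψ q
... | e , f | e′ , f′ = trans e e′ , λ A∈ → f (f′ A∈)
≤⇒⊆ψ (≤-merge {Y = Y} {X′} {ts₁} {ss} {ts₂} {us} cS us↭ cT) = up≡up , ⊆ψ
  where
  up≡up = trans (up-construct cS) (sym (up-construct cT))
  ⊆ψ : node (Y ∪ X′) us ⊆ψ node Y (ts₁ ++ node X′ ss ∷ ts₂)
  ⊆ψ (here refl) = here (sym up≡up)
  ⊆ψ (there A∈) with Any.++⁻ ss (Any-resp-↭ us↭ (∈-ψList⁻ us A∈))
  ... | inj₁ a = there (∈-ψList⁺ (Any.++⁺ʳ ts₁ (here (there (∈-ψList⁺ a)))))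
  ... | inj₂ a with Any.++⁻ ts₁ a
  ...   | inj₁ a₁ = there (∈-ψList⁺ (Any.++⁺ˡ a₁))
  ...   | inj₂ a₂ = there (∈-ψList⁺ (Any.++⁺ʳ ts₁ (there a₂)))
≤⇒⊆ψ (≤-child {Y = Y} {ts₁ = ts₁} {t} {t′} {ts₂} _ _ p) with ≤⇒⊆ψ p
... | e , f = up≡up , ⊆ψ
  where
  up≡up = cong (Y ∪_) (upList-child ts₁ e)
  ⊆ψ : node Y (ts₁ ++ t′ ∷ ts₂) ⊆ψ node Y (ts₁ ++ t ∷ ts₂)
  ⊆ψ (here refl) = here (sym up≡up)
  ⊆ψ (there A∈) with Any.++⁻ ts₁ (∈-ψList⁻ (ts₁ ++ t′ ∷ ts₂) A∈)
  ... | inj₁ a₁         = there (∈-ψList⁺ (Any.++⁺ˡ a₁))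
  ... | inj₂ (here a)   = there (∈-ψList⁺ (Any.++⁺ʳ ts₁ (here (f a))))
  ... | inj₂ (there a₂) = there (∈-ψList⁺ (Any.++⁺ʳ ts₁ (there a₂)))

pointwise-up : ∀ {R : Tree n → Tree n → Set} {ss ts} →
  (∀ {s t} → s ∈ˡ ss → t ∈ˡ ts → up s ≡ up t → R s t) → map up ss ≡ map up ts → Pointwise R ss ts
pointwise-up {ss = []}     {[]}     r e = []
pointwise-up {ss = s ∷ ss} {t ∷ ts} r e with List.∷-injective e
... | e₁ , e₂ = r (here refl) (here refl) e₁ ∷ pointwise-up (λ s∈ t∈ → r (there s∈) (there t∈)) e₂

module _ {n} {E : Hypergraph n} (E⊥ : E ⊥ ≡ false) where

  ∈-ψ-node : ∀ {X Y ts A} → Node E X Y ts → A ∈ˡ ψ (node Y ts) →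
    A ≡ X ⊎ (∃[ t ] (t ∈ˡ ts × A ∈ˡ ψ t))
  ∈-ψ-node v (here A≡)            = inj₁ (trans A≡ (Node.up≡ v))
  ∈-ψ-node {ts = ts} v (there A∈) = inj₂ (find (∈-ψList⁻ ts A∈))

  child∈ψ : ∀ {Y : Subset n} {ts t A} → t ∈ˡ ts → A ∈ˡ ψ t → A ∈ˡ ψ (node Y ts)
  child∈ψ t∈ A∈ = there (∈-ψList⁺ (lose t∈ A∈))

  child≢X : ∀ {X Y ts t A} → Node E X Y ts → t ∈ˡ ts → A ⊆ up t → A ≢ X
  child≢X v t∈ A⊆ refl with Node.root≢∅ v
  ... | i , i∈Y = Node.child-disjoint-root v t∈ i∈Y (A⊆ (Node.root⊆ v i∈Y))

  -- X is the only set of ψ(S) that meets the root label Z of S. A child of T has a set in ψ(S)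
  -- other than X, so it avoids Z.
  root-⊆ : ∀ {X Y Z ss ts} → Node E X Z ss → Node E X Y ts → node Y ts ⊆ψ node Z ss → Z ⊆ Y
  root-⊆ {X} {Y} {Z} {ss} {ts} vS vT T⊆S {i} i∈Z with i ∈? Y
  ... | yes i∈Y = i∈Y
  ... | no  i∉Y with Node.child-cover vT (Node.root⊆ vS i∈Z) i∉Y
  ...   | t , t∈ , i∈t with ∈-ψ-node vS (T⊆S (child∈ψ t∈ (up∈ψ t)))
  ...     | inj₁ t≡X             = ⊥-elim (child≢X vT t∈ id t≡X)
  ...     | inj₂ (s , s∈ , t∈ψs) = ⊥-elim (Node.child-disjoint-root vS s∈ i∈Z (ψ⇒⊆up s t∈ψs i∈t))

  -- A set of ψ(t) is connected, hence non-empty, and any element of it determines the child of S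
  -- below which it sits.
  child-⊆ψ : ∀ {X Z ss ts s t} → Node E X Z ss → Node E X Z ts → node Z ts ⊆ψ node Z ss →
    s ∈ˡ ss → t ∈ˡ ts → up s ≡ up t → t ⊆ψ s
  child-⊆ψ {t = t} vS vT T⊆S s∈ t∈ e {A} A∈ with ∈-ψ-node vS (T⊆S (child∈ψ t∈ A∈))
  ... | inj₁ A≡X = ⊥-elim (child≢X vT t∈ (ψ⇒⊆up t A∈) A≡X)
  ... | inj₂ (s′ , s′∈ , A∈s′)
    with All.lookup (ψ-sat E⊥ t (All.lookup (Node.constructs vT) t∈) (Node.child-sat vT t∈)) A∈
  ...   | (i , i∈A) , _ =
    subst (λ s → A ∈ˡ ψ s)
      (disjoint-unique up (Node.children-disjoint vS) s′∈ s∈ (ψ⇒⊆up s′ A∈s′ i∈A)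
        (subst (i ∈_) (sym e) (ψ⇒⊆up t A∈ i∈A)))
      A∈s′

  -- The canonical order makes this an equality of lists, so subtrees can be compared position by
  -- position.
  same-children : ∀ {X Z ss ts} → Node E X Z ss → Node E X Z ts → map up ss ≡ map up ts
  same-children vS vT =
    components-unique E E⊥ (Node.comps vS) (Node.comps vT) (Node.sorted vS) (Node.sorted vT)

  ψ-injective : ∀ S {X T} → Construct E X S → Construct E X T → T ⊆ψ S → S ⊆ψ T → S ≡ T
  ψ-injective = tree-ind step
    where
    step : ∀ {Z ss} →
      All (λ S → ∀ {X T} → Construct E X S → Construct E X T → T ⊆ψ S → S ⊆ψ T → S ≡ T) ss →
      ∀ {X T} → Construct E X (node Z ss) → Construct E X T → T ⊆ψ node Z ss → node Z ss ⊆ψ T → node Z ss ≡ T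
    step {Z} {ss} ih {X} {node Y ts} cS cT T⊆S S⊆T
      with ⊆-antisym (root-⊆ (view E⊥ cS) (view E⊥ cT) T⊆S) (root-⊆ (view E⊥ cT) (view E⊥ cS) S⊆T)
    ... | refl = cong (node Z) (Pointwise-≡⇒≡ (pointwise-up (λ {s} {t} s∈ t∈ e →
        All.lookup ih s∈ (All.lookup (Node.constructs vS) s∈)
          (subst (λ K → Construct E K t) (sym e) (All.lookup (Node.constructs vT) t∈))
          (child-⊆ψ vS vT T⊆S s∈ t∈ e) (child-⊆ψ vT vS S⊆T t∈ s∈ (sym e)))
        (same-children vS vT)))
      where
      vS = view E⊥ cS
      vT = view E⊥ cT

  -- Apart from `constructs`, a node sees its subtrees only through their tops.
  replace-children : ∀ {X Y ss ts} → map up ss ≡ map up ts → All (λ t → Construct E (up t) t) ts →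
    Node E X Y ss → Node E X Y ts
  replace-children {X} {Y} e cs v = record
    { root≢∅ = Node.root≢∅ v ; root⊆ = Node.root⊆ v
    ; comps = subst (Components E (X ─ Y)) e (Node.comps v)
    ; sorted = subst (AllPairs MinBefore) e (Node.sorted v)
    ; constructs = cs }

  -- `≤-child` replaces one subtree and asks that the source be a construct. The prefix `us` holds
  -- the subtrees already replaced, and the node is rebuilt after each replacement.
  children-≤ : ∀ {X Z} us {ss ts} →
    Pointwise (λ s t → up s ≡ up t × Construct E (up t) t × s ≤[ E ∣ up s ] t) ss ts →
    Node E X Z (us ++ ss) → node Z (us ++ ss) ≤[ E ∣ X ] node Z (us ++ ts)
  children-≤ us [] v = ≤-refl
  children-≤ {X} {Z} us {s ∷ ss} {t ∷ ts} ((e , c , s≤t) ∷ rs) v = ≤-trans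
    (≤-child (unview E⊥ v) (All.lookup (Node.constructs v) (∈-insert us)) s≤t)
    (subst₂ (λ ss ts → node Z ss ≤[ E ∣ X ] node Z ts)
      (List.++-assoc us [ t ] ss) (List.++-assoc us [ t ] ts)
      (children-≤ (us ++ [ t ]) rs
        (subst (Node E X Z) (sym (List.++-assoc us [ t ] ss)) (replace-children ups cs v))))
    where
    ups : map up (us ++ s ∷ ss) ≡ map up (us ++ t ∷ ss)
    ups = trans (List.map-++ up us (s ∷ ss))
         (trans (cong (λ A → map up us ++ A ∷ map up ss) e) (sym (List.map-++ up us (t ∷ ss))))
    cs : All (λ t → Construct E (up t) t) (us ++ t ∷ ss)
    cs = All.++⁺ (All.++⁻ˡ us (Node.constructs v)) (c ∷ All.tail (All.++⁻ʳ us (Node.constructs v)))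

  -- Removing X′ breaks up only the component containing it, whose pieces are the children `ss`; the
  -- other components survive. The pieces may interleave with `rest` in the canonical order, hence
  -- the sorting and the permutation.
  merge-node : ∀ {X Z X′ ss rest ts} → Node E X Z ts → ts ↭ node X′ ss ∷ rest →
    ∃[ us ] (us ↭ ss ++ rest × Node E X (Z ∪ X′) us)
  merge-node {X} {Z} {X′} {ss} {rest} {ts} v p = us , us↭ , record
    { root≢∅     = let i , i∈Z = V.root≢∅ in i , x∈p∪q⁺ (inj₁ i∈Z)
    ; root⊆      = root
    ; comps      = Components-resp-↭ E (map⁺ up (↭-sym us↭)) comps
    ; sorted     = AllPairs.map⁺ us-sorted
    ; constructs = All-resp-↭ (↭-sym us↭) (All.++⁺ W.constructs (All.tabulate λ t∈ → All.lookup V.constructs (rest⊆ t∈)))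
    }
    where
    module V = Node v
    s = node X′ ss
    s∈ : s ∈ˡ ts
    s∈ = ∈-resp-↭ (↭-sym p) (here refl)
    rest⊆ : ∀ {t} → t ∈ˡ rest → t ∈ˡ ts
    rest⊆ t∈ = ∈-resp-↭ (↭-sym p) (there t∈)
    w : Node E (up s) X′ ss
    w = view E⊥ (All.lookup V.constructs s∈)
    module W = Node w
    apart : AllPairs (Disjoint on up) (s ∷ rest)
    apart = ↭ₛ.AllPairs-resp-↭ (setoid _) Disjoint-sym ((λ { refl d → d }) , (λ { refl d → d }))
              (↭⇒↭ₛ p) V.children-disjoint
    child⊆s : ∀ {t} → t ∈ˡ ss → up t ⊆ up s
    child⊆s t∈ i∈t = p─q⊆p (up s) X′ (W.child⊆X─Y t∈ i∈t)
    ss++rest-disjoint : AllPairs (Disjoint on up) (ss ++ rest)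
    ss++rest-disjoint = AllPairs.++⁺ W.children-disjoint (AllPairs.tail apart)
      (All.tabulate λ t∈ → All.tabulate λ t′∈ → Disjoint-⊆ (child⊆s t∈) id (All.lookup (AllPairs.head apart) t′∈))
    root : Z ∪ X′ ⊆ X
    root i∈ with x∈p∪q⁻ Z X′ i∈
    ... | inj₁ i∈Z  = V.root⊆ i∈Z
    ... | inj₂ i∈X′ = p─q⊆p X Z (V.child⊆X─Y s∈ (W.root⊆ i∈X′))
    ∉Z∪X′ : ∀ {i} → i ∉ Z → i ∉ X′ → i ∉ Z ∪ X′
    ∉Z∪X′ i∉Z i∉X′ i∈ with x∈p∪q⁻ Z X′ i∈
    ... | inj₁ i∈Z  = i∉Z i∈Z
    ... | inj₂ i∈X′ = i∉X′ i∈X′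
    ─-Z : ∀ {i} → i ∈ X ─ (Z ∪ X′) → i ∈ X × i ∉ Z × i ∉ X′
    ─-Z i∈ = p─q⊆p X (Z ∪ X′) i∈ ,
      (λ i∈Z → x∈p─q⇒x∉q X (Z ∪ X′) i∈ (x∈p∪q⁺ (inj₁ i∈Z))) ,
      (λ i∈X′ → x∈p─q⇒x∉q X (Z ∪ X′) i∈ (x∈p∪q⁺ (inj₂ i∈X′)))
    cover : ∀ {i} → i ∈ X ─ (Z ∪ X′) → Any (λ t → i ∈ up t) (ss ++ rest)
    cover i∈ with ─-Z i∈
    ... | i∈X , i∉Z , i∉X′ with V.child-cover i∈X i∉Z
    ...   | t , t∈ , i∈t with ∈-resp-↭ p t∈
    ...     | there t∈′ = Any.++⁺ʳ ss (lose t∈′ i∈t)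
    ...     | here refl with W.child-cover i∈t i∉X′
    ...       | u , u∈ , i∈u = Any.++⁺ˡ (lose u∈ i∈u)
    edges : ∀ {W} → Edge E W → W ⊆ X ─ (Z ∪ X′) → Any (λ t → W ⊆ up t) (ss ++ rest)
    edges {W} e W⊆
      with find (Any.map⁻ (V.edges e λ i∈W → let i∈X , i∉Z , _ = ─-Z (W⊆ i∈W) in x∈p∧x∉q⇒x∈p─q i∈X i∉Z))
    ... | t , t∈ , W⊆t with ∈-resp-↭ p t∈
    ...   | there t∈′ = Any.++⁺ʳ ss (lose t∈′ W⊆t)
    ...   | here refl = Any.++⁺ˡ (Any.map⁻ (W.edges e λ i∈W →
              x∈p∧x∉q⇒x∈p─q (W⊆t i∈W) (proj₂ (proj₂ (─-Z (W⊆ i∈W))))))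
    comps : Components E (X ─ (Z ∪ X′)) (map up (ss ++ rest))
    comps = record
      { sat      = All.map⁺ (All.++⁺ (All.tabulate W.child-sat) (All.tabulate λ t∈ → V.child-sat (rest⊆ t∈)))
      ; disjoint = AllPairs.map⁺ ss++rest-disjoint
      ; inside   = All.map⁺ (All.++⁺
          (All.tabulate λ t∈ i∈t → let i∈X─Z = V.child⊆X─Y s∈ (child⊆s t∈ i∈t) in
            x∈p∧x∉q⇒x∈p─q (p─q⊆p X Z i∈X─Z)
              (∉Z∪X′ (x∈p─q⇒x∉q X Z i∈X─Z) (λ i∈X′ → W.child-disjoint-root t∈ i∈X′ i∈t)))
          (All.tabulate λ t∈ i∈t → let i∈X─Z = V.child⊆X─Y (rest⊆ t∈) i∈t in
            x∈p∧x∉q⇒x∈p─q (p─q⊆p X Z i∈X─Z)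
              (∉Z∪X′ (x∈p─q⇒x∉q X Z i∈X─Z)
                (λ i∈X′ → All.lookup (AllPairs.head apart) t∈ (W.root⊆ i∈X′) i∈t))))
      ; cover    = λ i∈ → Any.map⁺ (cover i∈)
      ; edges    = λ e W⊆ → Any.map⁺ (edges e W⊆)
      }
    sorted : ∃[ us ] (us ↭ ss ++ rest × AllPairs (MinBefore on up) us)
    sorted = sort-disjoint up (ss ++ rest)
      (All.++⁺ (All.tabulate λ t∈ → proj₁ (W.child-sat t∈)) (All.tabulate λ t∈ → proj₁ (V.child-sat (rest⊆ t∈))))
      ss++rest-disjoint
    us = proj₁ sorted
    us↭ = proj₁ (proj₂ sorted)
    us-sorted = proj₂ (proj₂ sorted)

  -- `root-⊆` bounds the root label Z of S by Y. As long as some y in Y lies outside Z, the child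
  -- containing y is merged; Z grows strictly, so this ends with Z = Y.
  ⊆ψ⇒≤ : ∀ T {X S} → Construct E X T → Construct E X S → T ⊆ψ S → S ≤[ E ∣ X ] T
  ⊆ψ⇒≤ = tree-ind step
    where
    step : ∀ {Y ts} →
      All (λ T → ∀ {X S} → Construct E X T → Construct E X S → T ⊆ψ S → S ≤[ E ∣ X ] T) ts →
      ∀ {X S} → Construct E X (node Y ts) → Construct E X S → node Y ts ⊆ψ S → S ≤[ E ∣ X ] node Y ts
    step {Y} {ts} ih {X} {node Z ss} cT = go Z (⊃-wellFounded Z) ss
      where
      vT = view E⊥ cT
      go : ∀ Z → Acc _⊃_ Z → ∀ ss → Construct E X (node Z ss) → node Y ts ⊆ψ node Z ss →
        node Z ss ≤[ E ∣ X ] node Y ts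
      go Z (acc rec) ss cS T⊆S with Y ⊆? Z
      ... | yes Y⊆Z with ⊆-antisym (root-⊆ (view E⊥ cS) vT T⊆S) Y⊆Z
      ...   | refl = children-≤ [] (pointwise-up (λ {s} {t} s∈ t∈ e →
                e , All.lookup (Node.constructs vT) t∈ ,
                All.lookup ih t∈
                  (subst (λ K → Construct E K t) (sym e) (All.lookup (Node.constructs vT) t∈))
                  (All.lookup (Node.constructs vS) s∈) (child-⊆ψ vS vT T⊆S s∈ t∈ e))
                (same-children vS vT)) vS
              where vS = view E⊥ cS
      go Z (acc rec) ss cS T⊆S | no Y⊈Z with ⊈⇒∃ Y Z Y⊈Z
      ... | y , y∈Y , y∉Z with Node.child-cover (view E⊥ cS) (Node.root⊆ vT y∈Y) y∉Z
      ...   | s@(node X′ ss′) , s∈ , y∈s with ∈-∃++ s∈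
      ...     | ts₁ , ts₂ , refl with merge-node (view E⊥ cS) (shift s ts₁ ts₂)
      ...       | us , us↭ , vU = ≤-trans (≤-merge cS us↭ (unview E⊥ vU))
                    (go (Z ∪ X′) (rec Z⊂Z∪X′) us (unview E⊥ vU) T⊆U)
        where
        vS = view E⊥ cS
        Z⊂Z∪X′ : Z ⊂ Z ∪ X′
        Z⊂Z∪X′ with view E⊥ (All.lookup (Node.constructs vS) s∈)
        ... | w with Node.root≢∅ w
        ...   | i , i∈X′ = p⊆p∪q X′ , i , x∈p∪q⁺ (inj₂ i∈X′) ,
                  λ i∈Z → Node.child-disjoint-root vS s∈ i∈Z (Node.root⊆ w i∈X′)
        -- Merging only removes up s, which contains y ∈ Y and so is not in ψ T.
        T⊆U : node Y ts ⊆ψ node (Z ∪ X′) us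
        T⊆U {A} A∈ with ∈-ψ-node vT A∈
        ... | inj₁ A≡X = here (trans A≡X (sym (Node.up≡ vU)))
        ... | inj₂ (t , t∈ , A∈t) with ∈-ψ-node vS (T⊆S A∈)
        ...   | inj₁ A≡X = here (trans A≡X (sym (Node.up≡ vU)))
        ...   | inj₂ (q , q∈ , A∈q) with ∈-resp-↭ (shift s ts₁ ts₂) q∈
        ...     | there q∈′ = child∈ψ (∈-resp-↭ (↭-sym us↭) (∈-++⁺ʳ ss′ q∈′)) A∈q
        ...     | here refl with A∈q
        ...       | here refl = ⊥-elim (Node.child-disjoint-root vT t∈ y∈Y (ψ⇒⊆up t A∈t y∈s))
        ...       | there A∈ss′ with find (∈-ψList⁻ ss′ A∈ss′)
        ...         | u , u∈ , A∈u = child∈ψ (∈-resp-↭ (↭-sym us↭) (∈-++⁺ˡ u∈)) A∈u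

-- Faces

Weights : ℕ → Set
Weights n = List (ℚ × Subset n)

-- The combination stays formal so that it can be evaluated both at the sums x(A) and at the bounds
-- 3^|A|.
weigh : Weights n → (Subset n → ℚ) → ℚ
weigh []            f = 0ℚ
weigh ((a , A) ∷ L) f = a * f A + weigh L f

Positive : Weights n → Set
Positive = All (λ (a , _) → 0ℚ ℚ.< a)

weigh-++ : ∀ (L L′ : Weights n) f → weigh (L ++ L′) f ≡ weigh L f + weigh L′ f
weigh-++ []            L′ f = sym (ℚ.+-identityˡ _)
weigh-++ ((a , A) ∷ L) L′ f =
  trans (cong (a * f A +_) (weigh-++ L L′ f)) (sym (ℚ.+-assoc (a * f A) (weigh L f) (weigh L′ f)))

weigh-cong : ∀ (L : Weights n) {f g} → All (λ A → f A ≡ g A) (map proj₂ L) → weigh L f ≡ weigh L g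
weigh-cong []            []       = refl
weigh-cong ((a , A) ∷ L) (e ∷ es) = cong₂ _+_ (cong (a *_) e) (weigh-cong L es)

weigh-mono : ∀ {L : Weights n} {f g} → Positive L → All (λ A → f A ℚ.≤ g A) (map proj₂ L) →
  weigh L f ℚ.≤ weigh L g
weigh-mono [] [] = ℚ.≤-refl
weigh-mono {L = (a , _) ∷ _} (a>0 ∷ pos) (le ∷ les) =
  ℚ.+-mono-≤ (ℚ.*-monoˡ-≤-nonNeg a {{ℚ.nonNegative (ℚ.<⇒≤ a>0)}} le) (weigh-mono pos les)

-- Complementary slackness: one strict inequality, multiplied by its positive weight, would make the
-- totals differ strictly.
weigh-tight : ∀ {L : Weights n} {f g} → Positive L → All (λ A → f A ℚ.≤ g A) (map proj₂ L) →
  weigh L g ℚ.≤ weigh L f → All (λ A → g A ≡ f A) (map proj₂ L)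
weigh-tight {L = []} [] [] _ = []
weigh-tight {L = (a , A) ∷ L} {f} {g} (a>0 ∷ pos) (le ∷ les) g≤f = head ∷ weigh-tight pos les tail
  where
  af≤ag : a * f A ℚ.≤ a * g A
  af≤ag = ℚ.*-monoˡ-≤-nonNeg a {{ℚ.nonNegative (ℚ.<⇒≤ a>0)}} le
  head : g A ≡ f A
  head with g A ℚ.≤? f A
  ... | yes gA≤fA = ℚ.≤-antisym gA≤fA le
  ... | no  gA≰fA = ⊥-elim (ℚ.<-irrefl refl (ℚ.<-≤-trans
          (ℚ.+-mono-<-≤ (ℚ.*-monoʳ-<-pos a {{ℚ.positive a>0}} (ℚ.≰⇒> gA≰fA)) (weigh-mono pos les)) g≤f))
  tail : weigh L g ℚ.≤ weigh L f
  tail with weigh L g ℚ.≤? weigh L f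
  ... | yes le′ = le′
  ... | no  gt  = ⊥-elim (ℚ.<-irrefl refl (ℚ.<-≤-trans (ℚ.+-mono-≤-< af≤ag (ℚ.≰⇒> gt)) g≤f))

-- c · x = M x(⊤) - Σ λ_A x(A) with all λ_A > 0: by duality, c attains its maximum
-- over 𝒢 exactly where all the sets A of the certificate are tight.
record Certificate {n} (X : Subset n) (M : ℚ) (As : List (Subset n)) (c : Point n) : Set where
  field
    weights  : Weights n
    positive : Positive weights
    sets     : map proj₂ weights ≡ As
    expand   : ∀ x → sumOver X (λ i → c i * x i) ≡ M * sumOver X x - weigh weights (λ A → sumOver A x)

module _ {n} (E : Hypergraph n) where

  𝒢⇒πplus : ∀ {x A} → 𝒢 E x → Sat E A → πplus A x
  𝒢⇒πplus {A = A} (ineq , eq) satA with ⊤ ⊆? A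
  ... | no  ⊤⊈A = ineq A satA λ { refl → ⊤⊈A id }
  ... | yes ⊤⊆A with ⊆-antisym ⊆⊤ ⊤⊆A
  ...   | refl = ℚ.≤-reflexive (sym eq)

  module _ {M As c} (cert : Certificate ⊤ M As c) (satAs : All (Sat E) As) where
    open Certificate cert

    -- The dual value: the right side of `expand` with every set tight.
    bound : ℚ
    bound = M * three^ ∣ ⊤ {n} ∣ - weigh weights (λ A → three^ ∣ A ∣)

    private
      expand-𝒢 : ∀ {x} → 𝒢 E x → dot c x ≡ M * three^ ∣ ⊤ {n} ∣ - weigh weights (λ A → sumOver A x)
      expand-𝒢 {x} (_ , eq) = trans (expand x) (cong (λ s → M * s - weigh weights (λ A → sumOver A x)) eq)

      above : ∀ {x} → 𝒢 E x → All (λ A → three^ ∣ A ∣ ℚ.≤ sumOver A x) (map proj₂ weights)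
      above g = All.map (𝒢⇒πplus g) (subst (All (Sat E)) (sym sets) satAs)

    certified-≤ : ∀ {x} → 𝒢 E x → dot c x ℚ.≤ bound
    certified-≤ g = ℚ.≤-trans (ℚ.≤-reflexive (expand-𝒢 g))
      (ℚ.+-monoʳ-≤ (M * three^ ∣ ⊤ {n} ∣) (ℚ.neg-antimono-≤ (weigh-mono positive (above g))))

    tight⇒max : ∀ {x} → Πof E As x → dot c x ≡ bound
    tight⇒max {x} (t , g) = trans (expand-𝒢 g)
      (cong (λ s → M * three^ ∣ ⊤ {n} ∣ - s)
        (weigh-cong weights (subst (All (λ A → πeq A x)) (sym sets) t)))

    max⇒tight : ∀ {x} → 𝒢 E x → dot c x ≡ bound → Πof E As x
    max⇒tight {x} g e = subst (All (λ A → πeq A x)) sets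
      (weigh-tight positive (above g) (ℚ.≤-reflexive
        (ℚ.neg-injective (∙-cancelˡ ℚ.+-0-group (M * three^ ∣ ⊤ {n} ∣) _ _ (trans (sym (expand-𝒢 g)) e))))) , g

    certified-face : IsFace (𝒢 E) (Πof E As)
    certified-face = c , bound , (λ _ → certified-≤) ,
      λ _ → (λ p → proj₂ p , tight⇒max p) , (λ (g , e) → max⇒tight g e)

sumOver-const-on-* : ∀ (A : Subset n) w x → sumOver ⊤ (λ i → const-on A w i * x i) ≡ w * sumOver A x
sumOver-const-on-* []          w x = sym (ℚ.*-zeroʳ w)
sumOver-const-on-* (true  ∷ A) w x =
  trans (cong (w * x zero +_) (sumOver-const-on-* A w (x ∘ suc))) (sym (ℚ.*-distribˡ-+ w (x zero) _))
sumOver-const-on-* (false ∷ A) w x =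
  trans (cong₂ _+_ (trans (ℚ.*-zeroˡ (x zero)) (sym (ℚ.*-zeroʳ w))) (sumOver-const-on-* A w (x ∘ suc)))
        (sym (ℚ.*-distribˡ-+ w 0ℚ _))

-- All multipliers are 1: maximising c means minimising the sum of all x(A), and each of them has
-- its own lower bound.
negated-sum : ∀ (As : List (Subset n)) → ∃[ c ] Certificate ⊤ 0ℚ As c
negated-sum {n} [] = (λ _ → 0ℚ) , record
  { weights = [] ; positive = [] ; sets = refl
  ; expand = λ x → trans (sumOver-vanish (⊤ {n}) λ i _ → ℚ.*-zeroˡ (x i))
                         (sym (trans (ℚ.+-identityʳ _) (ℚ.*-zeroˡ (sumOver ⊤ x)))) }
negated-sum {n} (A ∷ As) with negated-sum As
... | c , cert = (λ i → const-on A (- 1ℚ) i + c i) , record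
  { weights = (1ℚ , A) ∷ weights ; positive = ℚ.positive⁻¹ 1ℚ ∷ positive ; sets = cong (A ∷_) sets
  ; expand = λ x → begin
      sumOver ⊤ (λ i → (const-on A (- 1ℚ) i + c i) * x i)
        ≡⟨ sumOver-cong (⊤ {n}) (λ i _ → ℚ.*-distribʳ-+ (x i) (const-on A (- 1ℚ) i) (c i)) ⟩
      sumOver ⊤ (λ i → const-on A (- 1ℚ) i * x i + c i * x i)
        ≡⟨ sumOver-+ ⊤ (λ i → const-on A (- 1ℚ) i * x i) (λ i → c i * x i) ⟩
      sumOver ⊤ (λ i → const-on A (- 1ℚ) i * x i) + dot c x
        ≡⟨ cong₂ _+_ (sumOver-const-on-* A (- 1ℚ) x) (expand x) ⟩
      (- 1ℚ) * sumOver A x + (0ℚ * sumOver ⊤ x - weigh weights (λ A → sumOver A x))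
        ≡⟨ rearrange 1ℚ (sumOver A x) (0ℚ * sumOver ⊤ x) _ ⟩
      0ℚ * sumOver ⊤ x - (1ℚ * sumOver A x + weigh weights (λ A → sumOver A x)) ∎ }
  where
  open Certificate cert
  open ≡-Reasoning
  rearrange : ∀ u a z w → (- u) * a + (z - w) ≡ z - (u * a + w)
  rearrange = solve 4 (λ u a z w → (:- u) :* a :+ (z :- w) := z :- (u :* a :+ w)) refl
    where open +-*-Solver

-- The greedy construct of a functional

argmax : ∀ (c : Point n) (X : Subset n) → Nonempty X → ∃[ i ] (i ∈ X × (∀ {j} → j ∈ X → c j ℚ.≤ c i))
argmax c (false ∷ X) (suc i , there i∈X) with argmax (c ∘ suc) X (i , i∈X)
... | m , m∈X , max = suc m , there m∈X , λ { (there j∈X) → max j∈X }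
argmax c (true ∷ X) _ with nonempty? X
... | no X∅ = zero , here , λ { here → ℚ.≤-refl ; (there j∈X) → ⊥-elim (X∅ (_ , j∈X)) }
... | yes X≢∅ with argmax (c ∘ suc) X X≢∅
...   | m , m∈X , max with ℚ.≤-total (c zero) (c (suc m))
...     | inj₁ 0≤m = suc m , there m∈X , λ { here → 0≤m ; (there j∈X) → max j∈X }
...     | inj₂ m≤0 = zero , here , λ { here → ℚ.≤-refl ; (there j∈X) → ℚ.≤-trans (max j∈X) m≤0 }

module _ {n} (E : Hypergraph n) (E⊥ : E ⊥ ≡ false) (c : Point n) where

  -- M stands for the value of c on the label of the parent. The weight of X is M minus the maximum
  -- of c on X, so any M above c on X keeps it positive; M stays open until the parent fixes it.
  Greedy : Subset n → Tree n → Set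
  Greedy X T = Construct E X T × (∀ {M} → (∀ {i} → i ∈ X → c i ℚ.< M) → Certificate X M (ψ T) c)

  greedy-children : ∀ {Ks ts} → Pointwise Greedy Ks ts → AllPairs Disjoint Ks →
    ∀ {M} → (∀ {i} → i ∈ ⋃ Ks → c i ℚ.< M) → Certificate (⋃ Ks) M (ψList ts) c
  greedy-children [] [] {M} c<M = record
    { weights = [] ; positive = [] ; sets = refl
    ; expand = λ x → begin
        sumOver ⊥ (λ i → c i * x i)  ≡⟨ sumOver-⊥ (λ i → c i * x i) ⟩
        0ℚ                           ≡⟨ ℚ.*-zeroʳ M ⟨
        M * 0ℚ                       ≡⟨ cong (M *_) (sumOver-⊥ x) ⟨
        M * sumOver ⊥ x              ≡⟨ ℚ.+-identityʳ _ ⟨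
        M * sumOver ⊥ x - 0ℚ         ∎ }
    where open ≡-Reasoning
  greedy-children {K ∷ Ks} {t ∷ ts} ((_ , cert-t) ∷ gs) (d ∷ ds) {M} c<M = record
    { weights  = H.weights ++ R.weights
    ; positive = All.++⁺ H.positive R.positive
    ; sets     = trans (List.map-++ proj₂ H.weights R.weights) (cong₂ _++_ H.sets R.sets)
    ; expand   = λ x → let s = λ A → sumOver A x in begin
        sumOver (K ∪ ⋃ Ks) (λ i → c i * x i)
          ≡⟨ sumOver-∪ K (⋃ Ks) _ disj ⟩
        sumOver K (λ i → c i * x i) + sumOver (⋃ Ks) (λ i → c i * x i)
          ≡⟨ cong₂ _+_ (H.expand x) (R.expand x) ⟩
        (M * s K - weigh H.weights s) + (M * s (⋃ Ks) - weigh R.weights s)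
          ≡⟨ rearrange M (s K) (weigh H.weights s) (s (⋃ Ks)) (weigh R.weights s) ⟩
        M * (s K + s (⋃ Ks)) - (weigh H.weights s + weigh R.weights s)
          ≡⟨ cong₂ (λ a b → M * a - b) (sumOver-∪ K (⋃ Ks) x disj) (weigh-++ H.weights R.weights s) ⟨
        M * s (K ∪ ⋃ Ks) - weigh (H.weights ++ R.weights) s ∎ }
    where
    open ≡-Reasoning
    disj : Disjoint K (⋃ Ks)
    disj i∈K i∈Ks with find (∈-⋃⁻ Ks i∈Ks)
    ... | L , L∈ , i∈L = All.lookup d L∈ i∈K i∈L
    module H = Certificate (cert-t λ i∈K → c<M (x∈p∪q⁺ (inj₁ i∈K)))
    module R = Certificate (greedy-children gs ds λ i∈Ks → c<M (x∈p∪q⁺ (inj₂ i∈Ks)))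
    rearrange : ∀ m k a l b → (m * k - a) + (m * l - b) ≡ m * (k + l) - (a + b)
    rearrange = solve 5 (λ m k a l b → (m :* k :- a) :+ (m :* l :- b) := m :* (k :+ l) :- (a :+ b)) refl
      where open +-*-Solver

  private
    collect : ∀ {Ks} → All (λ K → ∃[ T ] Greedy K T) Ks → ∃[ ts ] Pointwise Greedy Ks ts
    collect [] = [] , []
    collect ((t , g) ∷ gs) with collect gs
    ... | ts , gs′ = t ∷ ts , g ∷ gs′

    greedy-up : ∀ {Ks ts} → Pointwise Greedy Ks ts → map up ts ≡ Ks
    greedy-up []             = refl
    greedy-up ((k , _) ∷ gs) = cong₂ _∷_ (up-construct k) (greedy-up gs)

    greedy-constructs : ∀ {Ks ts} → Pointwise Greedy Ks ts → All (λ t → Construct E (up t) t) ts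
    greedy-constructs []             = []
    greedy-constructs (_∷_ {y = t} (k , _) gs) =
      subst (λ K → Construct E K t) (sym (up-construct k)) k ∷ greedy-constructs gs

  greedy : ∀ X → Nonempty X → ∃[ T ] Greedy X T
  greedy X = go X (⊂-wellFounded X)
    where
    go : ∀ X → Acc _⊂_ X → Nonempty X → ∃[ T ] Greedy X T
    go X (acc rec) X≢∅ = node Y ts , unview E⊥ v , cert
      where
      top = argmax c X X≢∅
      a = proj₁ top
      a∈X = proj₁ (proj₂ top)
      max = proj₂ (proj₂ top)
      m = c a
      max? : ∀ i → Dec (i ∈ X × c i ≡ m)
      max? i = (i ∈? X) ×-dec (c i ℚ.≟ m)
      -- Taking all maximisers together makes c drop strictly from each label to the labels below
      -- it, which keeps the weights positive.
      Y : Subset n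
      Y = filterˢ max?
      Y⊆X : Y ⊆ X
      Y⊆X i∈Y = proj₁ (∈-filterˢ⁻ max? i∈Y)
      a∈Y : a ∈ Y
      a∈Y = ∈-filterˢ⁺ max? (a∈X , refl)
      below : ∀ {i} → i ∈ X ─ Y → c i ℚ.< m
      below {i} i∈ with m ℚ.≤? c i
      ... | no  m≰ = ℚ.≰⇒> m≰
      ... | yes m≤ = ⊥-elim (x∈p─q⇒x∉q X Y i∈
              (∈-filterˢ⁺ max? (p─q⊆p X Y i∈ , ℚ.≤-antisym (max (p─q⊆p X Y i∈)) m≤)))
      split = sorted-components E E⊥ (X ─ Y)
      Ks = proj₁ split
      module K = Components (proj₁ (proj₂ split))
      ⋃Ks≡ : ⋃ Ks ≡ X ─ Y
      ⋃Ks≡ = proj₁ (proj₂ (proj₂ (toIsComponents E (proj₁ (proj₂ split)))))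
      subtrees : ∃[ ts ] Pointwise Greedy Ks ts
      subtrees = collect (All.tabulate λ {K} K∈ → go K
        (rec ((λ i∈K → p─q⊆p X Y (All.lookup K.inside K∈ i∈K)) ,
              a , a∈X , λ a∈K → x∈p─q⇒x∉q X Y (All.lookup K.inside K∈ a∈K) a∈Y))
        (proj₁ (All.lookup K.sat K∈)))
      ts = proj₁ subtrees
      gs = proj₂ subtrees
      v : Node E X Y ts
      v = record
        { root≢∅ = a , a∈Y ; root⊆ = Y⊆X
        ; comps = subst (Components E (X ─ Y)) (sym (greedy-up gs)) (proj₁ (proj₂ split))
        ; sorted = subst (AllPairs MinBefore) (sym (greedy-up gs)) (proj₂ (proj₂ split))
        ; constructs = greedy-constructs gs }
      -- The children are certified at level m, the value of c on Y, which lies above c on all of X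
      -- ─ Y.
      module R = Certificate (subst (λ Z → Certificate Z m (ψList ts) c) ⋃Ks≡
        (greedy-children gs K.disjoint λ i∈ → below (subst (_ ∈_) ⋃Ks≡ i∈)))
      cert : ∀ {M} → (∀ {i} → i ∈ X → c i ℚ.< M) → Certificate X M (ψ (node Y ts)) c
      cert {M} c<M = record
        { weights  = (M - m , X) ∷ R.weights
        ; positive = subst (ℚ._< M - m) (ℚ.+-inverseʳ m) (ℚ.+-monoˡ-< (- m) (c<M a∈X)) ∷ R.positive
        ; sets     = cong₂ _∷_ (sym (Node.up≡ v)) R.sets
        ; expand   = λ x → let s = λ A → sumOver A x ; cx = λ i → c i * x i in begin
            sumOver X cx
              ≡⟨ cong (λ A → sumOver A cx) (q∪p─q≡p Y⊆X) ⟨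
            sumOver (Y ∪ (X ─ Y)) cx
              ≡⟨ sumOver-∪ Y (X ─ Y) cx (Disjoint-─ X Y) ⟩
            sumOver Y cx + sumOver (X ─ Y) cx
              ≡⟨ cong₂ _+_ (trans (sumOver-cong Y λ i i∈Y → cong (_* x i) (proj₂ (∈-filterˢ⁻ max? i∈Y)))
                                  (sumOver-* Y m x))
                           (R.expand x) ⟩
            -- Abel summation: writing m as M - (M - m) raises the level to M and creates the weight
            -- of X.
            m * s Y + (m * s (X ─ Y) - weigh R.weights s)
              ≡⟨ rearrange m M (s Y) (s (X ─ Y)) (weigh R.weights s) ⟩
            M * (s Y + s (X ─ Y)) - ((M - m) * (s Y + s (X ─ Y)) + weigh R.weights s)
              ≡⟨ cong (λ a → M * a - ((M - m) * a + weigh R.weights s))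
                   (trans (sym (sumOver-∪ Y (X ─ Y) x (Disjoint-─ X Y))) (cong s (q∪p─q≡p Y⊆X))) ⟩
            M * s X - ((M - m) * s X + weigh R.weights s) ∎ }
        where
        open ≡-Reasoning
        rearrange : ∀ m M y r w → m * y + (m * r - w) ≡ M * (y + r) - ((M - m) * (y + r) + w)
        rearrange = solve 5 (λ m M y r w → m :* y :+ (m :* r :- w) := M :* (y :+ r) :- ((M :- m) :* (y :+ r) :+ w)) refl
          where open +-*-Solver

-- Matching constructs with faces

module _ {n} (E : Hypergraph n) (E⊥ : E ⊥ ≡ false) where

  generic∈Π : ∀ {T} → Construct E ⊤ T → (g : GenericPoint E ⊤ (ψ T)) → Πof E (ψ T) (GenericPoint.point g)
  generic∈Π {T} k g = tight , plus , subst (λ X → πeq X point) (up-construct k) (All.lookup tight (up∈ψ T))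
    where
    open GenericPoint g
    plus : ∀ A → Sat E A → A ≢ ⊤ → πplus A point
    plus A satA _ = [ (λ A∈ → ℚ.≤-reflexive (sym (All.lookup tight A∈))) , ℚ.<⇒≤ ]′ (strict satA ⊆⊤)

  -- The generic point of S also lies in Π(ψ(T)), so every set of ψ(T) is tight at it, and only sets
  -- of ψ(S) can be.
  Π⊆⇒⊆ψ : ∀ {S T} → Sat E ⊤ → Construct E ⊤ S → Construct E ⊤ T →
    Πof E (ψ S) ⊆ₚ Πof E (ψ T) → T ⊆ψ S
  Π⊆⇒⊆ψ {S} {T} sat⊤ kS kT Π⊆ A∈ =
    [ id , (λ lt → ⊥-elim (ℚ.<-irrefl (sym (All.lookup (proj₁ (Π⊆ (generic∈Π kS g))) A∈)) lt)) ]′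
      (GenericPoint.strict g (All.lookup (ψ-sat E⊥ T kT sat⊤) A∈) ⊆⊤)
    where g = generic-point E E⊥ S kS

  ≤⇒Π⊆ : ∀ {S T} → S ≤[ E ∣ ⊤ ] T → Πof E (ψ S) ⊆ₚ Πof E (ψ T)
  ≤⇒Π⊆ S≤T (tight , g) = All.tabulate (λ A∈ → All.lookup tight (proj₂ (≤⇒⊆ψ S≤T) A∈)) , g

  -- Both d and the certified bound are upper bounds of c on 𝒢; x₀ attains the first and the generic
  -- point the second, so they agree. Non-emptiness of F excludes a d above the maximum.
  face-construct : Sat E ⊤ → ∀ F → IsFace (𝒢 E) F → (∃[ x ] F x) →
    ∃[ T ] (Construct E ⊤ T × Πof E (ψ T) ≐ F)
  face-construct sat⊤@(⊤≢∅ , _) F (c , d , c≤d , F⇔) (x₀ , Fx₀) = T , k ,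
    (λ p → proj₂ (F⇔ _) (proj₂ p , trans (tight⇒max E cert sat p) bound≡d)) ,
    (λ f → let 𝒢x , e = proj₁ (F⇔ _) f in max⇒tight E cert sat 𝒢x (trans e (sym bound≡d)))
    where
    T = proj₁ (greedy E E⊥ c ⊤ ⊤≢∅)
    k = proj₁ (proj₂ (greedy E E⊥ c ⊤ ⊤≢∅))
    a = proj₁ (argmax c ⊤ ⊤≢∅)
    max = proj₂ (proj₂ (argmax c ⊤ ⊤≢∅))
    sat = ψ-sat E⊥ T k sat⊤
    -- The level must exceed the maximum of c so that ⊤ receives a positive weight; the summand 1 is
    -- an arbitrary choice.
    cert : Certificate ⊤ (c a + 1ℚ) (ψ T) c
    cert = proj₂ (proj₂ (greedy E E⊥ c ⊤ ⊤≢∅)) λ i∈ → ℚ.≤-<-trans (max i∈)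
      (subst (ℚ._< c a + 1ℚ) (ℚ.+-identityʳ (c a)) (ℚ.+-monoʳ-< (c a) (ℚ.positive⁻¹ 1ℚ)))
    y∈Π = generic∈Π k (generic-point E E⊥ T k)
    bound≡d : bound E cert sat ≡ d
    bound≡d = ℚ.≤-antisym
      (ℚ.≤-trans (ℚ.≤-reflexive (sym (tight⇒max E cert sat y∈Π))) (c≤d _ (proj₂ y∈Π)))
      (let 𝒢x₀ , e = proj₁ (F⇔ x₀) Fx₀ in ℚ.≤-trans (ℚ.≤-reflexive (sym e)) (certified-≤ E cert sat 𝒢x₀))

theorem1 : ∀ (n : ℕ) (E : Hypergraph n) → IsHypergraph E → Atomic E → ConnectedHG E ⊤ →
    ((∀ T → Construct E ⊤ T → IsFace (𝒢 E) (Πof E (ψ T)) × (∃[ x ] Πof E (ψ T) x))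
    × (∀ S T → Construct E ⊤ S → Construct E ⊤ T → Πof E (ψ S) ≐ Πof E (ψ T) → S ≡ T)
    × (∀ (F : Pred (Point n) _) → IsFace (𝒢 E) F → (∃[ x ] F x) →
    ∃[ T ] (Construct E ⊤ T × Πof E (ψ T) ≐ F))
    × (∀ S T → Construct E ⊤ S → Construct E ⊤ T →
    (S ≤[ E ∣ ⊤ ] T → Πof E (ψ S) ⊆ₚ Πof E (ψ T))
    × (Πof E (ψ S) ⊆ₚ Πof E (ψ T) → S ≤[ E ∣ ⊤ ] T)))
-- On the empty carrier both sides are empty: a label needs an element, and the equation of 𝒢 reads
-- 0 = 3^0.
theorem1 zero E _ _ _ =
  (λ T k → ⊥-elim (no-construct k)) , (λ S T k _ _ → ⊥-elim (no-construct k)) ,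
  (λ F (c , d , _ , F⇔) (x , Fx) → ⊥-elim (no-point (proj₂ (proj₁ (proj₁ (F⇔ x) Fx))))) ,
  (λ S T k _ → ⊥-elim (no-construct k))
  where
  no-construct : ∀ {T} → ¬ Construct E ⊤ T
  no-construct (whole (() , _))
  no-construct (graft (() , _) _ _ _ _)
  no-point : 0ℚ ≢ three^ 0
  no-point ()
theorem1 (suc n) E (E⊥ , _) _ conn =
  (λ T k → let c , cert = negated-sum (ψ T) in
    certified-face E cert (ψ-sat E⊥ T k sat⊤) , _ , generic∈Π E E⊥ k (generic-point E E⊥ T k)) ,
  (λ S T kS kT (to , from) →
    ψ-injective E⊥ S kS kT (Π⊆⇒⊆ψ E E⊥ sat⊤ kS kT to) (Π⊆⇒⊆ψ E E⊥ sat⊤ kT kS from)) ,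
  face-construct E E⊥ sat⊤ ,
  (λ S T kS kT → ≤⇒Π⊆ E E⊥ , λ Π⊆ → ⊆ψ⇒≤ E⊥ T kT kS (Π⊆⇒⊆ψ E E⊥ sat⊤ kS kT Π⊆))
  where
  sat⊤ : Sat E ⊤
  sat⊤ = (zero , ∈⊤) , conn
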